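{- The function $K_2$ is continuous on $\big([0,1]\times[0,1]\big)\setminus\{(0,0)\}$.
   Context: Let $K:[0,1]\times[0,1]\to\mathbb R$ be defined by $K(x,y)=\frac12-\{(xy)^{ -1}\}$ if $0<x,y\le 1$, and $K(x,y)=0$ if $0\le x,y\le1$ and $xy=0$, where $\{\alpha\}=\alpha-\lfloor\alpha\rfloor$. Define $K_2(x,y)=\int_0^1K(x,z)K(z,y)\,dz$ for $0\le x,y\le1$. -}

-- The stdlib has no real numbers.  ℝ is taken here, as in classical analysis,
-- to be a complete ordered field (unique up to isomorphism), and excluded
-- middle is an explicit assumption wherever a classical definition needs it.
module Defs where

open import Level using (0ℓ)
open import Algebra.Bundles using (CommutativeRing)
open import Axiom.ExcludedMiddle using (ExcludedMiddle)
open import Data.Bool.Base using (if_then_else_)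
open import Data.Fin.Base using (Fin; inject₁; fromℕ) renaming (zero to fzero; suc to fsuc)
open import Data.Integer.Base as ℤ using (ℤ; +_; -[1+_])
open import Data.Nat.Base as ℕ using (ℕ)
open import Data.Product.Base using (Σ-syntax; ∃-syntax; _×_; _,_; proj₁; proj₂)
open import Data.Sum.Base using (inj₁; inj₂)
open import Relation.Binary.Core using (Rel)
open import Relation.Binary.Structures using (IsTotalOrder)
open import Relation.Nullary.Decidable.Core using (yes; no; does)
open import Relation.Nullary.Negation.Core using (¬_; contradiction)
import Algebra.Definitions.RawMonoid as RawMonoidDefinitions
import Algebra.Properties.CommutativeMonoid.Sum as CommutativeMonoidSum
import Algebra.Properties.Ring as RingProperties
import Relation.Binary.Construct.NonStrictToStrict as NonStrictToStrict

record CompleteOrderedField : Set₁ where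
  infix  4 _≤_
  infix  8 _⁻¹
  field
    commutativeRing : CommutativeRing 0ℓ 0ℓ

  open CommutativeRing commutativeRing public

  field
    _≤_           : Rel Carrier 0ℓ
    isTotalOrder  : IsTotalOrder _≈_ _≤_
    +-monoʳ-≤     : ∀ z {x y} → x ≤ y → z + x ≤ z + y
    *-nonNegative : ∀ {x y} → 0# ≤ x → 0# ≤ y → 0# ≤ x * y
    1≉0           : ¬ (1# ≈ 0#)
    -- The value of 0# ⁻¹ is unconstrained.
    _⁻¹           : Carrier → Carrier
    *-inverseʳ    : ∀ {x} → ¬ (x ≈ 0#) → x * x ⁻¹ ≈ 1#

  UpperBound : (Carrier → Set) → Carrier → Set
  UpperBound P b = ∀ x → P x → x ≤ b

  LowerBound : (Carrier → Set) → Carrier → Set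
  LowerBound P b = ∀ x → P x → b ≤ x

  IsSupremum : (Carrier → Set) → Carrier → Set
  IsSupremum P s = UpperBound P s × (∀ b → UpperBound P b → s ≤ b)

  IsInfimum : (Carrier → Set) → Carrier → Set
  IsInfimum P s = LowerBound P s × (∀ b → LowerBound P b → b ≤ s)

  field
    complete : (P : Carrier → Set) → ∃[ x ] P x → ∃[ b ] UpperBound P b →
               ∃[ s ] IsSupremum P s

  module Order = IsTotalOrder isTotalOrder

  open NonStrictToStrict _≈_ _≤_ public using (_<_; ≰⇒>)

  ∣_∣ : Carrier → Carrier
  ∣ x ∣ with Order.total 0# x
  ... | inj₁ _ = x
  ... | inj₂ _ = - x

  open RawMonoidDefinitions +-rawMonoid public using () renaming (_×_ to _·_)

  fromℤ : ℤ → Carrier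
  fromℤ (+ n)    = n · 1#
  fromℤ -[1+ n ] = - (ℕ.suc n · 1#)

module Floor (R : CompleteOrderedField) (lem : ExcludedMiddle 0ℓ) where

  open CompleteOrderedField R renaming (Carrier to ℝ)
  open RingProperties ring using (-0#≈0#; -1*x≈-x; -‿involutive; -‿+-comm)

  ≤-respˡ : ∀ {x y z} → x ≈ y → x ≤ z → y ≤ z
  ≤-respˡ e p = Order.trans (Order.reflexive (sym e)) p

  ≤-respʳ : ∀ {x y z} → y ≈ z → x ≤ y → x ≤ z
  ≤-respʳ e p = Order.trans p (Order.reflexive e)

  -x+[x+y]≈y : ∀ x y → - x + (x + y) ≈ y
  -x+[x+y]≈y x y =
    trans (sym (+-assoc (- x) x y)) (trans (+-congʳ (-‿inverseˡ x)) (+-identityˡ y))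

  neg-antimono-≤ : ∀ {x y} → x ≤ y → - y ≤ - x
  neg-antimono-≤ {x} {y} p =
    ≤-respˡ (trans (+-congʳ (+-comm (- x) (- y))) (cancelʳ (- y) x))
      (≤-respʳ (cancelʳ (- x) y) (+-monoʳ-≤ (- x + - y) p))
    where
    cancelʳ : ∀ u v → (u + - v) + v ≈ u
    cancelʳ u v =
      trans (+-assoc u (- v) v) (trans (+-congˡ (-‿inverseˡ v)) (+-identityʳ u))

  fromℤ-suc : ∀ k → fromℤ (ℤ.suc k) ≈ fromℤ k + 1#
  fromℤ-suc (+ n) = +-comm 1# (n · 1#)
  fromℤ-suc -[1+ 0 ] =
    sym (trans (+-congʳ (-‿cong (+-identityʳ 1#))) (-‿inverseˡ 1#))
  fromℤ-suc -[1+ ℕ.suc n ] =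
    sym (trans (+-congʳ (sym (-‿+-comm 1# (ℕ.suc n · 1#))))
      (trans (+-comm _ 1#)
        (trans (sym (+-assoc 1# (- 1#) _))
          (trans (+-congʳ (-‿inverseʳ 1#)) (+-identityˡ _)))))

  -- If every suc n · 1# were ≤ α, these multiples would have a supremum s,
  -- and - 1# + s would be a smaller upper bound.
  archimedean : ∀ α → ∃[ n ] α ≤ ℕ.suc n · 1# × ¬ (α ≈ ℕ.suc n · 1#)
  archimedean α with lem {∃[ n ] ¬ (ℕ.suc n · 1# ≤ α)}
  ... | yes (n , ¬q) = n , ≰⇒> sym Order.reflexive Order.total ¬q
  ... | no ¬p = contradiction (Order.antisym 1≤0 0≤1) 1≉0
    where
    P : ℝ → Set
    P x = ∃[ n ] x ≈ ℕ.suc n · 1#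

    bounded : ∀ n → ℕ.suc n · 1# ≤ α
    bounded n with lem {ℕ.suc n · 1# ≤ α}
    ... | yes q = q
    ... | no ¬q = contradiction (n , ¬q) ¬p

    supremum : ∃[ s ] IsSupremum P s
    supremum = complete P (_ , 0 , refl) (α , λ x (n , e) → ≤-respˡ (sym e) (bounded n))

    s : ℝ
    s = proj₁ supremum

    s≤-1+s : s ≤ - 1# + s
    s≤-1+s = proj₂ (proj₂ supremum) (- 1# + s) λ x (n , e) →
      ≤-respˡ (trans (-x+[x+y]≈y 1# (ℕ.suc n · 1#)) (sym e))
        (+-monoʳ-≤ (- 1#) (proj₁ (proj₂ supremum) _ (ℕ.suc n , refl)))

    0≤-1 : 0# ≤ - 1#
    0≤-1 = ≤-respˡ (-‿inverseˡ s)
      (≤-respʳ (trans (+-congˡ (+-comm (- 1#) s)) (-x+[x+y]≈y s (- 1#)))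
        (+-monoʳ-≤ (- s) s≤-1+s))

    0≤1 : 0# ≤ 1#
    0≤1 = ≤-respʳ (trans (-1*x≈-x (- 1#)) (-‿involutive 1#)) (*-nonNegative 0≤-1 0≤-1)

    1≤0 : 1# ≤ 0#
    1≤0 = ≤-respˡ (-‿involutive 1#) (≤-respʳ -0#≈0# (neg-antimono-≤ 0≤-1))

  IsFloor : ℝ → ℤ → Set
  IsFloor α k = fromℤ k ≤ α × α < fromℤ k + 1#

  floorAbove : ∀ α d k → fromℤ k ≤ α → α < fromℤ k + d · 1# → ∃[ m ] IsFloor α m
  floorAbove α ℕ.zero k k≤α (α≤k+0 , α≉k+0) =
    contradiction (Order.antisym α≤k+0 (≤-respˡ (sym (+-identityʳ _)) k≤α)) α≉k+0
  floorAbove α (ℕ.suc d) k k≤α (α≤ , α≉) with lem {fromℤ (ℤ.suc k) ≤ α}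
  ... | yes k+1≤α = floorAbove α d (ℤ.suc k) k+1≤α (≤-respʳ e α≤ , λ q → α≉ (trans q (sym e)))
    where
    e : fromℤ k + (1# + d · 1#) ≈ fromℤ (ℤ.suc k) + d · 1#
    e = trans (sym (+-assoc _ _ _)) (+-congʳ (sym (fromℤ-suc k)))
  ... | no k+1≰α with ≰⇒> sym Order.reflexive Order.total k+1≰α
  ...   | α≤k+1 , α≉k+1 =
    k , k≤α , ≤-respʳ (fromℤ-suc k) α≤k+1 , λ q → α≉k+1 (trans q (sym (fromℤ-suc k)))

  floor : ∀ α → ∃[ k ] IsFloor α k
  floor α with archimedean (- α)
  ... | m , -α≤M , _ with archimedean (α + ℕ.suc m · 1#)
  ...   | d , α+M≤D , α+M≉D =
    floorAbove α (ℕ.suc d) -[1+ m ]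
      (≤-respʳ (-‿involutive α) (neg-antimono-≤ -α≤M))
      (≤-respˡ e (+-monoʳ-≤ (- M) α+M≤D) , λ q →
        α+M≉D (trans (+-congʳ q) (trans (+-comm _ M)
          (trans (sym (+-assoc M (- M) _)) (trans (+-congʳ (-‿inverseʳ M)) (+-identityˡ _))))))
    where
    M : ℝ
    M = ℕ.suc m · 1#
    e : - M + (α + M) ≈ α
    e = trans (+-congˡ (+-comm α M)) (-x+[x+y]≈y M α)

  ⌊_⌋ : ℝ → ℤ
  ⌊ α ⌋ = proj₁ (floor α)

  frac : ℝ → ℝ
  frac α = α - fromℤ ⌊ α ⌋

module Integral (R : CompleteOrderedField) (lem : ExcludedMiddle 0ℓ) where

  open CompleteOrderedField R renaming (Carrier to ℝ)
  open CommutativeMonoidSum +-commutativeMonoid using (sum)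

  -- The values at the partition points play no role and are not recorded.
  record StepFunction (a b : ℝ) : Set where
    field
      pieces   : ℕ
      point    : Fin (ℕ.suc pieces) → ℝ
      value    : Fin pieces → ℝ
      start    : point fzero ≈ a
      end      : point (fromℕ pieces) ≈ b
      monotone : ∀ i → point (inject₁ i) ≤ point (fsuc i)

    stepIntegral : ℝ
    stepIntegral = sum λ i → value i * (point (fsuc i) - point (inject₁ i))

    Below : (ℝ → ℝ) → Set
    Below f = ∀ i z → point (inject₁ i) < z → z < point (fsuc i) → value i ≤ f z

    Above : (ℝ → ℝ) → Set
    Above f = ∀ i z → point (inject₁ i) < z → z < point (fsuc i) → f z ≤ value i

  open StepFunction

  IsLowerSum : ℝ → ℝ → (ℝ → ℝ) → ℝ → Set
  IsLowerSum a b f x = Σ[ φ ∈ StepFunction a b ] Below φ f × x ≈ stepIntegral φ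

  IsUpperSum : ℝ → ℝ → (ℝ → ℝ) → ℝ → Set
  IsUpperSum a b f x = Σ[ φ ∈ StepFunction a b ] Above φ f × x ≈ stepIntegral φ

  -- Riemann–Darboux integral over [a,b], for a ≤ b.
  IsIntegral : ℝ → ℝ → (ℝ → ℝ) → ℝ → Set
  IsIntegral a b f I = IsSupremum (IsLowerSum a b f) I × IsInfimum (IsUpperSum a b f) I

  -- Equal to 0# when f is not Riemann integrable on [a,b].
  integral : ℝ → ℝ → (ℝ → ℝ) → ℝ
  integral a b f with lem {∃[ I ] IsIntegral a b f I}
  ... | yes (I , _) = I
  ... | no _        = 0#

module Kernel (R : CompleteOrderedField) (lem : ExcludedMiddle 0ℓ) where

  open CompleteOrderedField R renaming (Carrier to ℝ)
  open Floor R lem using (frac)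
  open Integral R lem using (integral)

  ½ : ℝ
  ½ = (1# + 1#) ⁻¹

  -- Only the values of K and K₂ on the unit square are meaningful.
  K : ℝ → ℝ → ℝ
  K x y = if does (lem {0# < x × 0# < y}) then ½ - frac ((x * y) ⁻¹) else 0#

  -- For x and y in [0,1] the integrand is bounded and has at most countably
  -- many discontinuities, so its Riemann and Lebesgue integrals exist and agree.
  K₂ : ℝ → ℝ → ℝ
  K₂ x y = integral 0# 1# λ z → K x z * K z y

module Continuity (R : CompleteOrderedField) where

  open CompleteOrderedField R renaming (Carrier to ℝ)

  PuncturedUnitSquare : ℝ → ℝ → Set
  PuncturedUnitSquare x y =
    (0# ≤ x × x ≤ 1#) × (0# ≤ y × y ≤ 1#) × ¬ (x ≈ 0# × y ≈ 0#)

  -- Continuity of the restriction of F to D, with the maximum metric on ℝ².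
  ContinuousOn : (ℝ → ℝ → Set) → (ℝ → ℝ → ℝ) → Set
  ContinuousOn D F =
    ∀ x y → D x y → ∀ ε → 0# < ε →
    ∃[ δ ] 0# < δ × (∀ x′ y′ → D x′ y′ → ∣ x′ - x ∣ < δ → ∣ y′ - y ∣ < δ →
                     ∣ F x′ y′ - F x y ∣ < ε)

{-# OPTIONS --safe #-}
-- Write K(x,z) = s(1/(xz)) with the sawtooth s(t) = ½ - {t}.  As s is the
-- difference of the increasing functions ½ + ⌊t⌋ and t, its oscillation between
-- two points is at most the increment of V(t) = t + ⌊t⌋.  On [η,1] these
-- increments telescope, so Riemann sums on a uniform grid of mesh h approximate
-- K₂(x,y) with an error η + h (V(1/(xη)) + V(1/(yη))), and for x, y > 0 the same
-- telescoping bounds the change of the Riemann sum when (x,y) moves.  As x → 0,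
-- summation by parts against a periodic antiderivative of s bounds the Riemann
-- sum by x (V(1/(yη)) + 4) up to a multiple of h, so that K₂ tends to 0 at
-- every point of the axis x = 0 other than the origin.
module Submission where

open import Defs
open import Level using (0ℓ)
open import Axiom.ExcludedMiddle using (ExcludedMiddle)
open import Algebra.Solver.Ring.AlmostCommutativeRing
  using (fromCommutativeRing; _-Raw-AlmostCommutative⟶_)
open import Data.Bool.Base using (if_then_else_)
open import Data.Fin.Base using (Fin; inject₁; fromℕ; toℕ) renaming (zero to fzero; suc to fsuc)
open import Data.Fin.Properties using (toℕ-inject₁; toℕ-fromℕ)
open import Data.Integer.Base as ℤ using (ℤ; +_; -[1+_]; _⊖_)
import Data.Integer.Properties as ℤ
open import Data.Maybe.Base using (map)
open import Data.Nat.Base as ℕ using (ℕ; zero; suc)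
import Data.Nat.Properties as ℕ
open import Data.Product.Base using (∃-syntax; _×_; _,_; proj₁; proj₂)
open import Data.Sum.Base using (_⊎_; inj₁; inj₂)
open import Function.Base using (_∘_; flip)
open import Relation.Binary.Definitions using (Tri; tri<; tri≈; tri>)
open import Relation.Binary.PropositionalEquality.Core as ≡ using (_≡_)
open import Relation.Nullary.Decidable.Core using (Dec; yes; no; does; dec⇒maybe)
open import Relation.Nullary.Negation.Core using (¬_; contradiction)
import Algebra.Properties.CommutativeMonoid.Sum as CommutativeMonoidSum
import Algebra.Properties.Ring as RingProperties
import Algebra.Properties.Semiring.Mult.TCOptimised as Mult
import Algebra.Solver.Ring as RingSolver

-- For fixed z > 0 the value `K x z` oscillates without limit as x tends to 0, so only cancellation
-- can make the integral small. It comes from the constant ½: the sawtooth has mean zero over a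
-- period, hence a bounded periodic antiderivative.
--
-- The order of choices matters. V(1/(xη)) is finite for fixed x and η but blows up as either tends
-- to 0. So η is fixed before h, and near the axis x = 0 this quantity occurs only multiplied by h:
-- the mesh may depend on the point, and refining it removes the term before x is made small. What
-- remains carries the factor x and involves only y, which has to stay away from 0; at the origin
-- this breaks down.
--
-- All estimates are made on finite sums, where telescoping takes the place of a change of variables
-- and of dominated convergence.

-- A ring solver with integer coefficients.

module IntegerRingSolver (R : CompleteOrderedField) where

  open CompleteOrderedField R
  open RingProperties ring
  open Mult semiring using (×-homo-+; ×1-homo-*; 1+×) renaming (_×_ to _•_)
  open import Relation.Binary.Reasoning.Setoid setoid

  -- With this form of multiple, `1 • 1#` reduces to `1#` and `2 • 1#` to `1# + 1#`, so the
  -- constants of the solver match the terms in the goals definitionally.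
  ⟦_⟧ℤ : ℤ → Carrier
  ⟦ + n ⟧ℤ      = n • 1#
  ⟦ -[1+ n ] ⟧ℤ = - (ℕ.suc n • 1#)

  cancelˡ : ∀ a x y → x - y ≈ (a + x) - (a + y)
  cancelˡ a x y = sym (begin
    (a + x) - (a + y)       ≈⟨ +-congˡ (-‿+-comm a y) ⟨
    (a + x) + (- a + - y)   ≈⟨ +-congʳ (+-comm a x) ⟩
    (x + a) + (- a + - y)   ≈⟨ +-assoc x a _ ⟩
    x + (a + (- a + - y))   ≈⟨ +-congˡ (+-assoc a (- a) (- y)) ⟨
    x + ((a + - a) + - y)   ≈⟨ +-congˡ (+-congʳ (-‿inverseʳ a)) ⟩
    x + (0# + - y)          ≈⟨ +-congˡ (+-identityˡ (- y)) ⟩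
    x - y                   ∎)

  -‿homo : ∀ i → ⟦ ℤ.- i ⟧ℤ ≈ - ⟦ i ⟧ℤ
  -‿homo (+ 0)       = sym -0#≈0#
  -‿homo (+ ℕ.suc n) = refl
  -‿homo -[1+ n ]    = sym (-‿involutive _)

  ⊖-homo : ∀ m n → ⟦ m ⊖ n ⟧ℤ ≈ m • 1# - n • 1#
  ⊖-homo m 0 = sym (trans (+-congˡ -0#≈0#) (+-identityʳ _))
  ⊖-homo 0 (ℕ.suc n) = sym (+-identityˡ _)
  ⊖-homo (ℕ.suc m) (ℕ.suc n) = begin
    ⟦ ℕ.suc m ⊖ ℕ.suc n ⟧ℤ           ≡⟨ ≡.cong ⟦_⟧ℤ (ℤ.[1+m]⊖[1+n]≡m⊖n m n) ⟩
    ⟦ m ⊖ n ⟧ℤ                       ≈⟨ ⊖-homo m n ⟩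
    m • 1# - n • 1#                  ≈⟨ cancelˡ 1# _ _ ⟩
    (1# + m • 1#) - (1# + n • 1#)    ≈⟨ +-cong (1+× m 1#) (-‿cong (1+× n 1#)) ⟨
    ℕ.suc m • 1# - ℕ.suc n • 1#      ∎

  +-homo : ∀ i j → ⟦ i ℤ.+ j ⟧ℤ ≈ ⟦ i ⟧ℤ + ⟦ j ⟧ℤ
  +-homo (+ m)    (+ n)    = ×-homo-+ 1# m n
  +-homo (+ m)    -[1+ n ] = ⊖-homo m (ℕ.suc n)
  +-homo -[1+ m ] (+ n)    = trans (⊖-homo n (ℕ.suc m)) (+-comm _ _)
  +-homo -[1+ m ] -[1+ n ] = begin
    ⟦ -[1+ m ] ℤ.+ -[1+ n ] ⟧ℤ              ≡⟨ ≡.cong ⟦_⟧ℤ (ℤ.neg-distrib-+ (+ ℕ.suc m) (+ ℕ.suc n)) ⟨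
    ⟦ ℤ.- (+ (ℕ.suc m ℕ.+ ℕ.suc n)) ⟧ℤ      ≈⟨ -‿homo (+ (ℕ.suc m ℕ.+ ℕ.suc n)) ⟩
    - ((ℕ.suc m ℕ.+ ℕ.suc n) • 1#)          ≈⟨ -‿cong (×-homo-+ 1# (ℕ.suc m) (ℕ.suc n)) ⟩
    - (ℕ.suc m • 1# + ℕ.suc n • 1#)         ≈⟨ -‿+-comm _ _ ⟨
    ⟦ -[1+ m ] ⟧ℤ + ⟦ -[1+ n ] ⟧ℤ           ∎

  *-homo-pos : ∀ m j → ⟦ + m ℤ.* j ⟧ℤ ≈ m • 1# * ⟦ j ⟧ℤ
  *-homo-pos m (+ n) = begin
    ⟦ + m ℤ.* + n ⟧ℤ     ≡⟨ ≡.cong ⟦_⟧ℤ (ℤ.pos-* m n) ⟨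
    (m ℕ.* n) • 1#       ≈⟨ ×1-homo-* m n ⟩
    m • 1# * n • 1#      ∎
  *-homo-pos m -[1+ n ] = begin
    ⟦ + m ℤ.* -[1+ n ] ⟧ℤ               ≡⟨ ≡.cong ⟦_⟧ℤ (ℤ.neg-distribʳ-* (+ m) (+ ℕ.suc n)) ⟨
    ⟦ ℤ.- (+ m ℤ.* + ℕ.suc n) ⟧ℤ        ≈⟨ -‿homo (+ m ℤ.* + ℕ.suc n) ⟩
    - ⟦ + m ℤ.* + ℕ.suc n ⟧ℤ            ≈⟨ -‿cong (*-homo-pos m (+ ℕ.suc n)) ⟩
    - (m • 1# * ℕ.suc n • 1#)           ≈⟨ -‿distribʳ-* _ _ ⟩
    m • 1# * ⟦ -[1+ n ] ⟧ℤ              ∎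

  *-homo : ∀ i j → ⟦ i ℤ.* j ⟧ℤ ≈ ⟦ i ⟧ℤ * ⟦ j ⟧ℤ
  *-homo (+ m) j = *-homo-pos m j
  *-homo -[1+ m ] j = begin
    ⟦ -[1+ m ] ℤ.* j ⟧ℤ             ≡⟨ ≡.cong ⟦_⟧ℤ (ℤ.neg-distribˡ-* (+ ℕ.suc m) j) ⟨
    ⟦ ℤ.- (+ ℕ.suc m ℤ.* j) ⟧ℤ      ≈⟨ -‿homo (+ ℕ.suc m ℤ.* j) ⟩
    - ⟦ + ℕ.suc m ℤ.* j ⟧ℤ          ≈⟨ -‿cong (*-homo-pos (ℕ.suc m) j) ⟩
    - (ℕ.suc m • 1# * ⟦ j ⟧ℤ)       ≈⟨ -‿distribˡ-* _ _ ⟩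
    ⟦ -[1+ m ] ⟧ℤ * ⟦ j ⟧ℤ          ∎

  morphism : ℤ.+-*-rawRing -Raw-AlmostCommutative⟶ fromCommutativeRing commutativeRing
  morphism = record
    { ⟦_⟧    = ⟦_⟧ℤ
    ; +-homo = +-homo
    ; *-homo = *-homo
    ; -‿homo = -‿homo
    ; 0-homo = refl
    ; 1-homo = refl
    }

  open RingSolver ℤ.+-*-rawRing (fromCommutativeRing commutativeRing) morphism
    (λ i j → map (λ e → reflexive (≡.cong ⟦_⟧ℤ e)) (dec⇒maybe (i ℤ.≟ j))) public
    using (solve; _:=_; _:+_; _:*_; _:-_; :-_; con; Polynomial)

-- Inequalities in an ordered field, by nonnegativity certificates.

module OrderedField (R : CompleteOrderedField) (lem : ExcludedMiddle 0ℓ) where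

  open CompleteOrderedField R public renaming (Carrier to ℝ)
  open Order public using () renaming (refl to ≤-refl; trans to ≤-trans; antisym to ≤-antisym;
    total to ≤-total; reflexive to ≤-reflexive)
  open Floor R lem public using (≤-respˡ; ≤-respʳ; neg-antimono-≤)
  open IntegerRingSolver R public
    using (solve; _:=_; _:+_; _:*_; _:-_; :-_; con; Polynomial)

  :1 :2 : ∀ {n} → Polynomial n
  :1 = con (+ 1)
  :2 = con (+ 2)

  2# : ℝ
  2# = 1# + 1#

  0≤y-x : ∀ {x y} → x ≤ y → 0# ≤ y - x
  0≤y-x {x} {y} p = ≤-respˡ (-‿inverseˡ x) (≤-respʳ (+-comm (- x) y) (+-monoʳ-≤ (- x) p))

  -- The certificate `d` is a sum of products of quantities known to be nonnegative; the ring solver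
  -- checks the identity.
  ≤-cert : ∀ {x y d} → 0# ≤ d → y - x ≈ d → x ≤ y
  ≤-cert {x} {y} p e =
    ≤-respˡ (+-identityʳ x) (≤-respʳ (solve 2 (λ x y → x :+ (y :- x) := y) refl x y)
      (+-monoʳ-≤ x (≤-respʳ (sym e) p)))

  infixl 6 _⊕_
  infixl 7 _⊗_

  _⊕_ : ∀ {x y} → 0# ≤ x → 0# ≤ y → 0# ≤ x + y
  _⊕_ {x} {y} p q = ≤-trans p (≤-respˡ (+-identityʳ x) (+-monoʳ-≤ x q))

  _⊗_ : ∀ {x y} → 0# ≤ x → 0# ≤ y → 0# ≤ x * y
  _⊗_ = *-nonNegative

  -- Lets an equation enter a certificate: its difference is zero, so the multiplier `k` may have
  -- either sign.
  ≈⇒0≤*- : ∀ {x y} k → x ≈ y → 0# ≤ k * (x - y)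
  ≈⇒0≤*- {x} {y} k e = ≤-reflexive (sym (trans (*-congˡ (trans (+-congʳ e) (-‿inverseʳ y))) (zeroʳ k)))

  +-mono-≤ : ∀ {a b c d} → a ≤ b → c ≤ d → a + c ≤ b + d
  +-mono-≤ {a} {b} {c} {d} p q = ≤-cert (0≤y-x p ⊕ 0≤y-x q)
    (solve 4 (λ a b c d → (b :+ d) :- (a :+ c) := (b :- a) :+ (d :- c)) refl a b c d)

  *-monoˡ-≤ : ∀ {a b c} → 0# ≤ c → a ≤ b → c * a ≤ c * b
  *-monoˡ-≤ {a} {b} {c} p q = ≤-cert (p ⊗ 0≤y-x q)
    (solve 3 (λ a b c → (c :* b) :- (c :* a) := c :* (b :- a)) refl a b c)

  0≤1 : 0# ≤ 1#
  0≤1 with ≤-total 0# 1#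
  ... | inj₁ p = p
  ... | inj₂ p = ≤-respʳ (solve 0 ((con (+ 0) :- :1) :* (con (+ 0) :- :1) := :1) refl) (0≤y-x p ⊗ 0≤y-x p)

  0≤2 : 0# ≤ 2#
  0≤2 = 0≤1 ⊕ 0≤1

  4# : ℝ
  4# = 2# + 2#

  0≤4 : 0# ≤ 4#
  0≤4 = 0≤2 ⊕ 0≤2

  ≰⇒≥ : ∀ {x y} → ¬ x ≤ y → y ≤ x
  ≰⇒≥ {x} {y} p with ≤-total x y
  ... | inj₁ q = contradiction q p
  ... | inj₂ q = q

  <⇒≰ : ∀ {x y} → x < y → ¬ y ≤ x
  <⇒≰ (p , ne) q = ne (≤-antisym p q)

  ≰⇒< : ∀ {x y} → ¬ y ≤ x → x < y
  ≰⇒< p = ≰⇒≥ p , λ e → p (≤-reflexive (sym e))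

  <-≤-trans : ∀ {x y z} → x < y → y ≤ z → x < z
  <-≤-trans p q = ≰⇒< λ r → <⇒≰ p (≤-trans q r)

  ≤-<-trans : ∀ {x y z} → x ≤ y → y < z → x < z
  ≤-<-trans p q = ≰⇒< λ r → <⇒≰ q (≤-trans r p)

  0<⇒≉0 : ∀ {x} → 0# < x → ¬ (x ≈ 0#)
  0<⇒≉0 p e = proj₂ p (sym e)

  0<1 : 0# < 1#
  0<1 = 0≤1 , λ e → 1≉0 (sym e)

  0<y-x : ∀ {x y} → x < y → 0# < y - x
  0<y-x {x} {y} (p , ne) = 0≤y-x p , λ e → ne (trans
    (solve 1 (λ x → x := x :+ con (+ 0)) refl x) (trans (+-congˡ e)
    (solve 2 (λ x y → x :+ (y :- x) := y) refl x y)))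

  0<⇒0<+ : ∀ {x y} → 0# < x → 0# ≤ y → 0# < x + y
  0<⇒0<+ {x} {y} p q = <-≤-trans p (≤-cert q (solve 2 (λ x y → (x :+ y) :- x := y) refl x y))

  0<2 : 0# < 2#
  0<2 = 0<⇒0<+ 0<1 0≤1

  ⁻¹-nonNegative : ∀ {x} → 0# < x → 0# ≤ x ⁻¹
  ⁻¹-nonNegative {x} p with ≤-total 0# (x ⁻¹)
  ... | inj₁ q = q
  ... | inj₂ q = contradiction
    (≤-cert (proj₁ p ⊗ 0≤y-x q ⊕ ≈⇒0≤*- 1# (*-inverseʳ (0<⇒≉0 p)))
      (solve 2 (λ x i → con (+ 0) :- :1 := x :* (con (+ 0) :- i) :+ :1 :* (x :* i :- :1)) refl x (x ⁻¹)))
    (<⇒≰ 0<1)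

  ⁻¹-positive : ∀ {x} → 0# < x → 0# < x ⁻¹
  ⁻¹-positive {x} p = ⁻¹-nonNegative p , λ e →
    1≉0 (trans (sym (*-inverseʳ (0<⇒≉0 p))) (trans (*-congˡ (sym e)) (zeroʳ x)))

  *-positive : ∀ {x y} → 0# < x → 0# < y → 0# < x * y
  *-positive {x} {y} p q = proj₁ p ⊗ proj₁ q , λ e → 0<⇒≉0 q (begin
    y                ≈⟨ *-identityˡ y ⟨
    1# * y           ≈⟨ *-congʳ (*-inverseʳ (0<⇒≉0 p)) ⟨
    x * x ⁻¹ * y     ≈⟨ solve 3 (λ x i y → x :* i :* y := i :* (x :* y)) refl x (x ⁻¹) y ⟩
    x ⁻¹ * (x * y)   ≈⟨ *-congˡ e ⟨
    x ⁻¹ * 0#        ≈⟨ zeroʳ _ ⟩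
    0#               ∎)
    where open import Relation.Binary.Reasoning.Setoid setoid

  ⁻¹-antitone : ∀ {x y} → 0# < x → x ≤ y → y ⁻¹ ≤ x ⁻¹
  ⁻¹-antitone {x} {y} p q = ≤-cert
    (⁻¹-nonNegative p ⊗ ⁻¹-nonNegative 0<y ⊗ 0≤y-x q
      ⊕ ≈⇒0≤*- (x ⁻¹) (sym (*-inverseʳ (0<⇒≉0 0<y))) ⊕ ≈⇒0≤*- (y ⁻¹) (*-inverseʳ (0<⇒≉0 p)))
    (solve 4 (λ x i y j → i :- j := i :* j :* (y :- x) :+ i :* (:1 :- y :* j) :+ j :* (x :* i :- :1))
      refl x (x ⁻¹) y (y ⁻¹))
    where 0<y = <-≤-trans p q

  half-nonNegative : ∀ {x} → 0# ≤ x + x → 0# ≤ x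
  half-nonNegative {x} p with ≤-total 0# x
  ... | inj₁ q = q
  ... | inj₂ q = ≤-cert (p ⊕ 0≤y-x q) (solve 1 (λ x → x :- con (+ 0) := (x :+ x) :+ (con (+ 0) :- x)) refl x)

  ½ : ℝ
  ½ = 2# ⁻¹

  0<½ : 0# < ½
  0<½ = ⁻¹-positive 0<2

  2½≈1 : 2# * ½ ≈ 1#
  2½≈1 = *-inverseʳ (0<⇒≉0 0<2)

  minimum : ∀ {a b} → 0# < a → 0# < b → ∃[ c ] 0# < c × c ≤ a × c ≤ b
  minimum {a} {b} p q with ≤-total a b
  ... | inj₁ r = a , p , ≤-refl , r
  ... | inj₂ r = b , q , r , ≤-refl

  infix 4 _◁_

  -- |a| ≤ b, in the form that certificates by the ring solver can use.
  _◁_ : ℝ → ℝ → Set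
  a ◁ b = a ≤ b × - a ≤ b

  ◁-resp : ∀ {a a′ b b′} → a ≈ a′ → b ≈ b′ → a ◁ b → a′ ◁ b′
  ◁-resp e f (p , q) = ≤-respˡ e (≤-respʳ f p) , ≤-respˡ (-‿cong e) (≤-respʳ f q)

  ◁-weaken : ∀ {a b b′} → a ◁ b → b ≤ b′ → a ◁ b′
  ◁-weaken (p , q) r = ≤-trans p r , ≤-trans q r

  ◁-neg : ∀ {a b} → a ◁ b → - a ◁ b
  ◁-neg {a} (p , q) = q , ≤-respˡ (solve 1 (λ a → a := :- (:- a)) refl a) p

  ◁-+ : ∀ {a b c d} → a ◁ b → c ◁ d → a + c ◁ b + d
  ◁-+ {a} {b} {c} {d} (p , q) (r , s) = +-mono-≤ p r ,
    ≤-respˡ (solve 2 (λ a c → (:- a) :+ (:- c) := :- (a :+ c)) refl a c) (+-mono-≤ q s)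

  0≤⇒◁ : ∀ {a b} → 0# ≤ a → a ≤ b → a ◁ b
  0≤⇒◁ {a} {b} p q = q ,
    ≤-cert (p ⊕ p ⊕ 0≤y-x q) (solve 2 (λ a b → b :- (:- a) := a :+ a :+ (b :- a)) refl a b)

  ◁-scale : ∀ {a b c} → 0# ≤ c → a ◁ b → c * a ◁ c * b
  ◁-scale {a} {b} {c} p (q , r) = *-monoˡ-≤ p q ,
    ≤-respˡ (solve 2 (λ a c → c :* (:- a) := :- (c :* a)) refl a c) (*-monoˡ-≤ p r)

  -- No case split on signs: (b - a)(d + c) + (b + a)(d - c) = 2(bd - ac) has nonnegative summands,
  -- and replacing c by -c gives the other half.
  ◁-* : ∀ {a b c d} → a ◁ b → c ◁ d → a * c ◁ b * d
  ◁-* {a} {b} {c} {d} (p , q) (r , s) =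
    ≤-cert (half-nonNegative (≤-respʳ
        (solve 4 (λ a b c d → (b :- a) :* (d :- (:- c)) :+ (b :- (:- a)) :* (d :- c)
          := (b :* d :- a :* c) :+ (b :* d :- a :* c)) refl a b c d)
        (0≤y-x p ⊗ 0≤y-x s ⊕ 0≤y-x q ⊗ 0≤y-x r))) refl ,
    ≤-cert (half-nonNegative (≤-respʳ
        (solve 4 (λ a b c d → (b :- a) :* (d :- c) :+ (b :- (:- a)) :* (d :- (:- c))
          := (b :* d :- (:- (a :* c))) :+ (b :* d :- (:- (a :* c)))) refl a b c d)
        (0≤y-x p ⊗ 0≤y-x r ⊕ 0≤y-x q ⊗ 0≤y-x s))) refl

  ∣∣-◁ : ∀ a → a ◁ ∣ a ∣
  ∣∣-◁ a with ≤-total 0# a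
  ... | inj₁ p = 0≤⇒◁ p ≤-refl
  ... | inj₂ p =
    ≤-cert (0≤y-x p ⊕ 0≤y-x p)
      (solve 1 (λ a → (:- a) :- a := (con (+ 0) :- a) :+ (con (+ 0) :- a)) refl a) , ≤-refl

  ◁⇒∣∣≤ : ∀ {a b} → a ◁ b → ∣ a ∣ ≤ b
  ◁⇒∣∣≤ {a} (p , q) with ≤-total 0# a
  ... | inj₁ _ = p
  ... | inj₂ _ = q

-- Telescoping sums and Darboux integrals.

module IntegralEstimates (R : CompleteOrderedField) (lem : ExcludedMiddle 0ℓ) where

  open OrderedField R lem
  open Integral R lem
  open CommutativeMonoidSum +-commutativeMonoid using (sum; sum-cong-≋; sum-cong-≗)

  Σ : ℕ → (ℕ → ℝ) → ℝ
  Σ n a = sum {n} (a ∘ toℕ)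

  Σ-cong : ∀ n {a b : ℕ → ℝ} → (∀ i → a i ≈ b i) → Σ n a ≈ Σ n b
  Σ-cong n p = sum-cong-≋ {n} (p ∘ toℕ)

  Σ-≤-telescope : ∀ n {a b d : ℕ → ℝ} → (∀ i → a i ≤ b i + (d i - d (suc i))) →
                  Σ n a ≤ Σ n b + (d 0 - d n)
  Σ-≤-telescope zero {d = d} _ =
    ≤-reflexive (solve 1 (λ d → con (+ 0) := con (+ 0) :+ (d :- d)) refl (d 0))
  Σ-≤-telescope (suc n) {a} {b} {d} p =
    ≤-respʳ (solve 5 (λ b s d₀ d₁ dₙ →
        (b :+ (d₀ :- d₁)) :+ (s :+ (d₁ :- dₙ)) := (b :+ s) :+ (d₀ :- dₙ))
        refl (b 0) (Σ n (b ∘ suc)) (d 0) (d 1) (d (suc n)))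
      (+-mono-≤ (p 0) (Σ-≤-telescope n (p ∘ suc)))

  Σ-◁-telescope : ∀ n {a b d : ℕ → ℝ} →
                  (∀ i → i ℕ.< n → a i - b i ◁ d i - d (suc i)) →
                  Σ n a - Σ n b ◁ d 0 - d n
  Σ-◁-telescope zero {d = d} _ =
    ◁-resp (solve 0 (con (+ 0) := con (+ 0) :- con (+ 0)) refl)
           (solve 1 (λ d → con (+ 0) := d :- d) refl (d 0)) (0≤⇒◁ ≤-refl ≤-refl)
  Σ-◁-telescope (suc n) {a} {b} {d} p =
    ◁-resp (solve 4 (λ a b s t → (a :- b) :+ (s :- t) := (a :+ s) :- (b :+ t))
             refl (a 0) (b 0) (Σ n (a ∘ suc)) (Σ n (b ∘ suc)))
           (solve 3 (λ d₀ d₁ dₙ → (d₀ :- d₁) :+ (d₁ :- dₙ) := d₀ :- dₙ) refl (d 0) (d 1) (d (suc n)))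
      (◁-+ (p 0 ℕ.z<s) (Σ-◁-telescope n (λ i i<n → p (suc i) (ℕ.s<s i<n))))

  Σ-telescope : ∀ n (b : ℕ → ℝ) → Σ n (λ i → b i - b (suc i)) ≈ b 0 - b n
  Σ-telescope zero    b = sym (-‿inverseʳ (b 0))
  Σ-telescope (suc n) b = trans (+-congˡ (Σ-telescope n (b ∘ suc)))
    (solve 3 (λ b₀ b₁ bₙ → (b₀ :- b₁) :+ (b₁ :- bₙ) := b₀ :- bₙ) refl (b 0) (b 1) (b (suc n)))

  -- A step function as a list of pieces, indexed by its left end and its integral. Unlike the
  -- `Fin`-indexed record, this form supports recursion on two partitions at once.
  data Steps (P : ℝ → ℝ → Set) (b : ℝ) : ℝ → ℝ → Set where
    stop : ∀ {a} → a ≈ b → Steps P b a 0#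
    step : ∀ {a c v J} → a ≤ c → (∀ z → a < z → z < c → P v z) →
           Steps P b c J → Steps P b a (v * (c - a) + J)

  toSteps : ∀ {P b} n (p : Fin (suc n) → ℝ) (v : Fin n → ℝ) → p (fromℕ n) ≈ b →
            (∀ i → p (inject₁ i) ≤ p (fsuc i)) →
            (∀ i z → p (inject₁ i) < z → z < p (fsuc i) → P (v i) z) →
            Steps P b (p fzero) (sum λ i → v i * (p (fsuc i) - p (inject₁ i)))
  toSteps zero    p v end mono valid = stop end
  toSteps (suc n) p v end mono valid = step (mono fzero) (valid fzero)
    (toSteps n (p ∘ fsuc) (v ∘ fsuc) end (mono ∘ fsuc) (valid ∘ fsuc))

  Steps-≤ : ∀ {P b a J} → Steps P b a J → a ≤ b
  Steps-≤ (stop e)       = ≤-reflexive e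
  Steps-≤ (step a≤c _ s) = ≤-trans a≤c (Steps-≤ s)

  Steps-degenerate : ∀ {P b a J} → Steps P b a J → b ≤ a → J ≈ 0#
  Steps-degenerate (stop _) _ = refl
  Steps-degenerate {a = a} (step {c = c} {v} {J} a≤c _ s) b≤a =
    trans (+-cong (*-congˡ (trans (+-congʳ c≈a) (-‿inverseʳ a))) (Steps-degenerate s (≤-trans b≤a a≤c)))
          (trans (+-identityʳ _) (zeroʳ v))
    where c≈a = ≤-antisym (≤-trans (Steps-≤ s) b≤a) a≤c

  midpoint : ∀ {a c} → a < c → ∃[ z ] a < z × z < c
  midpoint {a} {c} a<c = a + ½ * (c - a) ,
    ≰⇒< (λ q → <⇒≰ 0<h (≤-cert (0≤y-x q)
      (solve 2 (λ a h → con (+ 0) :- h := a :- (a :+ h)) refl a (½ * (c - a))))) ,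
    ≰⇒< (λ q → <⇒≰ 0<h (≤-cert (0≤y-x q ⊕ ≈⇒0≤*- (c - a) (sym 2½≈1))
      (solve 3 (λ a c k → con (+ 0) :- k :* (c :- a) :=
        ((a :+ k :* (c :- a)) :- c) :+ (c :- a) :* (:1 :- :2 :* k)) refl a c ½)))
    where
    0<h : 0# < ½ * (c - a)
    0<h = *-positive 0<½ (0<y-x a<c)

  ≤-approximation : ∀ {x y} → (∀ ε → 0# < ε → x ≤ y + 2# * ε) → x ≤ y
  ≤-approximation {x} {y} p with lem {x ≤ y}
  ... | yes x≤y = x≤y
  ... | no x≰y  = ≤-cert
    -- With ε = (x - y)/4 the hypothesis reads x - y ≤ (x - y)/2.
    (0≤2 ⊗ 0≤y-x (p (½ * ½ * (x - y)) (*-positive (*-positive 0<½ 0<½) (0<y-x (≰⇒< x≰y))))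
      ⊕ ≈⇒0≤*- ((x - y) * (2# * ½ + 1#)) (sym 2½≈1))
    (solve 3 (λ x y k → y :- x :=
        :2 :* (y :+ :2 :* (k :* k :* (x :- y)) :- x)
        :+ (x :- y) :* (:2 :* k :+ :1) :* (:1 :- :2 :* k))
      refl x y ½)

  module _ (f : ℝ → ℝ) where

    Lower Upper : ℝ → ℝ → Set
    Lower v z = v ≤ f z
    Upper v z = f z ≤ v

    -- On a piece of positive width the midpoint compares `v` with `w` through `f`. A degenerate
    -- piece has no interior point, but there the factor `c - a` vanishes.
    piece-≤ : ∀ {a c v w} → a ≤ c → (∀ z → a < z → z < c → Lower v z) →
              (∀ z → a < z → z < c → Upper w z) → v * (c - a) ≤ w * (c - a)
    piece-≤ {a} {c} {v} {w} a≤c vf fw = ≤-cert (cases (lem {c ≤ a}))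
      (solve 4 (λ a c v w → w :* (c :- a) :- v :* (c :- a) := (w :- v) :* (c :- a)) refl a c v w)
      where
      cases : Dec (c ≤ a) → 0# ≤ (w - v) * (c - a)
      cases (yes c≤a) = ≈⇒0≤*- (w - v) (≤-antisym c≤a a≤c)
      cases (no c≰a)  = let z , a<z , z<c = midpoint (≰⇒< c≰a) in
        0≤y-x (≤-trans (vf z a<z z<c) (fw z a<z z<c)) ⊗ 0≤y-x a≤c

    -- The first pieces are [a,c] and [a,d]; each step cuts at the smaller of c and d.
    merge-≤ : ∀ {b a c d v w I J} → a ≤ c → a ≤ d →
              (∀ z → a < z → z < c → Lower v z) → (∀ z → a < z → z < d → Upper w z) →
              Steps Lower b c I → Steps Upper b d J →
              v * (c - a) + I ≤ w * (d - a) + J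
    merge-≤ {b} {a} {c} {d} {v} {w} {I} {J} a≤c a≤d vf fw φ ψ with ≤-total c d
    ... | inj₁ c≤d = cut φ
      where
      first : v * (c - a) ≤ w * (c - a)
      first = piece-≤ a≤c vf (λ z a<z z<c → fw z a<z (<-≤-trans z<c c≤d))
      cut : ∀ {I} → Steps Lower b c I → v * (c - a) + I ≤ w * (d - a) + J
      cut (stop c≈b) = ≤-cert
        (0≤y-x first ⊕ ≈⇒0≤*- w (≤-antisym d≤c c≤d)
          ⊕ ≈⇒0≤*- 1# (Steps-degenerate ψ (≤-trans (≤-reflexive (sym c≈b)) c≤d)))
        (solve 6 (λ a c d v w J → (w :* (d :- a) :+ J) :- (v :* (c :- a) :+ con (+ 0)) :=
            w :* (c :- a) :- v :* (c :- a) :+ w :* (d :- c) :+ :1 :* (J :- con (+ 0)))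
          refl a c d v w J)
        where d≤c = ≤-trans (Steps-≤ ψ) (≤-reflexive (sym c≈b))
      cut (step {c = c′} {v′} {I′} c≤c′ vf′ φ′) = ≤-cert
        (0≤y-x first ⊕ 0≤y-x (merge-≤ c≤c′ c≤d vf′ (λ z c<z → fw z (≤-<-trans a≤c c<z)) φ′ ψ))
        (solve 8 (λ a c d v w J K I′ → (w :* (d :- a) :+ J) :- (v :* (c :- a) :+ (K :+ I′)) :=
            w :* (c :- a) :- v :* (c :- a) :+ (w :* (d :- c) :+ J :- (K :+ I′)))
          refl a c d v w J (v′ * (c′ - c)) I′)
    ... | inj₂ d≤c = cut ψ
      where
      first : v * (d - a) ≤ w * (d - a)
      first = piece-≤ a≤d (λ z a<z z<d → vf z a<z (<-≤-trans z<d d≤c)) fw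
      cut : ∀ {J} → Steps Upper b d J → v * (c - a) + I ≤ w * (d - a) + J
      cut (stop d≈b) = ≤-cert
        (0≤y-x first ⊕ ≈⇒0≤*- v (≤-antisym d≤c c≤d)
          ⊕ ≈⇒0≤*- 1# (sym (Steps-degenerate φ (≤-trans (≤-reflexive (sym d≈b)) d≤c))))
        (solve 6 (λ a c d v w I → (w :* (d :- a) :+ con (+ 0)) :- (v :* (c :- a) :+ I) :=
            w :* (d :- a) :- v :* (d :- a) :+ v :* (d :- c) :+ :1 :* (con (+ 0) :- I))
          refl a c d v w I)
        where c≤d = ≤-trans (Steps-≤ φ) (≤-reflexive (sym d≈b))
      cut (step {c = d′} {w′} {J′} d≤d′ fw′ ψ′) = ≤-cert
        (0≤y-x first ⊕ 0≤y-x (merge-≤ d≤c d≤d′ (λ z d<z → vf z (≤-<-trans a≤d d<z)) fw′ φ ψ′))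
        (solve 8 (λ a c d v w I K J′ → (w :* (d :- a) :+ (K :+ J′)) :- (v :* (c :- a) :+ I) :=
            w :* (d :- a) :- v :* (d :- a) :+ (K :+ J′ :- (v :* (c :- d) :+ I)))
          refl a c d v w I (w′ * (d′ - d)) J′)

    lowerSum≤upperSum : ∀ {a b x y} → IsLowerSum a b f x → IsUpperSum a b f y → x ≤ y
    lowerSum≤upperSum {a} {x = x} {y} (φ , below , x≈) (ψ , above , y≈) =
      ≤-respˡ (sym x≈) (≤-respʳ (sym y≈) (≤-cert
        -- Merging needs one common left end, whereas the two first partition points are only `≈ a`.
        -- Degenerate pieces of value `0#` from `a` to these points bridge the difference.
        (0≤y-x (merge-≤ {a = a} {v = 0#} {0#} (≤-reflexive (sym φ.start)) (≤-reflexive (sym ψ.start))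
          (λ z a<z z<p → contradiction (≤-trans (proj₁ z<p) (≤-reflexive φ.start)) (<⇒≰ a<z))
          (λ z a<z z<p → contradiction (≤-trans (proj₁ z<p) (≤-reflexive ψ.start)) (<⇒≰ a<z))
          (toSteps φ.pieces φ.point φ.value φ.end φ.monotone below)
          (toSteps ψ.pieces ψ.point ψ.value ψ.end ψ.monotone above)))
        (solve 4 (λ x y k l → y :- x := (con (+ 0) :* k :+ y) :- (con (+ 0) :* l :+ x)) refl
          φ.stepIntegral ψ.stepIntegral _ _)))
      where
      module φ = StepFunction φ
      module ψ = StepFunction ψ

    -- One object for two uses: small `E` gives integrability, and any `E` locates the integral
    -- within `E` of `C`.
    record Sandwich (C E : ℝ) : Set where
      field
        {L U}    : ℝ
        lowerSum : IsLowerSum 0# 1# f L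
        upperSum : IsUpperSum 0# 1# f U
        C-E≤L    : C - E ≤ L
        U≤C+E    : U ≤ C + E

    open Sandwich

    Sandwich-resp : ∀ {C C′ E E′} → C ≈ C′ → E ≤ E′ → Sandwich C E → Sandwich C′ E′
    Sandwich-resp {C} {C′} {E} {E′} e p S = record
      { lowerSum = lowerSum S
      ; upperSum = upperSum S
      ; C-E≤L    = ≤-trans (+-mono-≤ (≤-reflexive (sym e)) (neg-antimono-≤ p)) (C-E≤L S)
      ; U≤C+E    = ≤-trans (U≤C+E S) (+-mono-≤ (≤-reflexive e) p)
      }

    -- `integral` falls back to `0#` when no integral exists, so existence has to be supplied before
    -- anything can be said about its value.
    integral-isIntegral : ∀ {a b} → ∃[ I ] IsIntegral a b f I → IsIntegral a b f (integral a b f)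
    integral-isIntegral {a} {b} ∃I with lem {∃[ I ] IsIntegral a b f I}
    ... | yes (_ , isIntegral) = isIntegral
    ... | no ¬∃I               = contradiction ∃I ¬∃I

    -- The supremum of the lower sums is the candidate. It is below every upper sum, and a sandwich
    -- leaves a gap of at most 2ε between it and any lower bound of the upper sums.
    squeeze⇒integrable : (∀ ε → 0# < ε → ∃[ C ] ∃[ E ] Sandwich C E × E ≤ ε) →
                         ∃[ I ] IsIntegral 0# 1# f I
    squeeze⇒integrable fine = I , isSup , lb , λ b b-lower → ≤-approximation (gap b b-lower)
      where
      S = proj₁ (proj₂ (proj₂ (fine 1# 0<1)))
      supremum = complete (IsLowerSum 0# 1# f) (_ , lowerSum S)
        (_ , λ x x-lower → lowerSum≤upperSum x-lower (upperSum S))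
      I = proj₁ supremum
      isSup = proj₂ supremum
      lb : LowerBound (IsUpperSum 0# 1# f) I
      lb y y-upper = proj₂ isSup y λ x x-lower → lowerSum≤upperSum x-lower y-upper
      gap : ∀ b → LowerBound (IsUpperSum 0# 1# f) b → ∀ ε → 0# < ε → b ≤ I + 2# * ε
      gap b b-lower ε 0<ε = let C , E , T , E≤ε = fine ε 0<ε in ≤-cert
        (0≤2 ⊗ 0≤y-x E≤ε ⊕ 0≤y-x (b-lower _ (upperSum T)) ⊕ 0≤y-x (U≤C+E T)
          ⊕ 0≤y-x (C-E≤L T) ⊕ 0≤y-x (proj₁ isSup _ (lowerSum T)))
        (solve 7 (λ b I C E L U ε → I :+ :2 :* ε :- b :=
            :2 :* (ε :- E) :+ (U :- b) :+ ((C :+ E) :- U) :+ (L :- (C :- E)) :+ (I :- L))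
          refl b I C E (L T) (U T) ε)

    integral-◁ : (∀ ε → 0# < ε → ∃[ C ] ∃[ E ] Sandwich C E × E ≤ ε) →
                 ∀ {C E} → Sandwich C E → integral 0# 1# f - C ◁ E
    integral-◁ fine {C} {E} S =
      ≤-cert (0≤y-x (proj₁ inf _ (upperSum S)) ⊕ 0≤y-x (U≤C+E S))
        (solve 4 (λ C E I U → E :- (I :- C) := U :- I :+ ((C :+ E) :- U)) refl C E I (U S)) ,
      ≤-cert (0≤y-x (proj₁ sup _ (lowerSum S)) ⊕ 0≤y-x (C-E≤L S))
        (solve 4 (λ C E I L → E :- (:- (I :- C)) := I :- L :+ (L :- (C :- E))) refl C E I (L S))
      where
      I   = integral 0# 1# f
      sup = proj₁ (integral-isIntegral (squeeze⇒integrable fine))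
      inf = proj₂ (integral-isIntegral (squeeze⇒integrable fine))

    -- The step functions with values c ± e enclose `f`. The potential `d` makes the total error
    -- telescope, so that no error has to be small on an individual cell.
    sandwich : ∀ N {p c e d : ℕ → ℝ} → p 0 ≈ 0# → p N ≈ 1# → (∀ i → p i ≤ p (suc i)) →
               (∀ i z → p i < z → z < p (suc i) → f z - c i ◁ e i) →
               (∀ i → e i * (p (suc i) - p i) ≤ d i - d (suc i)) →
               Sandwich (Σ N (λ i → c i * (p (suc i) - p i))) (d 0 - d N)
    sandwich N {p} {c} {e} {d} start end mono close osc = record
      { lowerSum = stepFunction (λ i → c i - e i) ,
          (λ i z p<z z<p → ≤-cert (0≤y-x (proj₂ (close′ i z p<z z<p)))
            (solve 3 (λ f c e → f :- (c :- e) := e :- (:- (f :- c))) refl (f z) (c (toℕ i)) (e (toℕ i)))) ,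
          refl
      ; upperSum = stepFunction (λ i → c i + e i) ,
          (λ i z p<z z<p → ≤-cert (0≤y-x (proj₁ (close′ i z p<z z<p)))
            (solve 3 (λ f c e → (c :+ e) :- f := e :- (f :- c)) refl (f z) (c (toℕ i)) (e (toℕ i)))) ,
          refl
      ; C-E≤L = ≤-cert (0≤y-x (≤-respʳ (+-congʳ (sym (integral-Σ (λ i → c i - e i))))
            (Σ-≤-telescope N {d = d} (λ i → ≤-cert (0≤y-x (osc i))
              (solve 5 (λ c e h d d′ → ((c :- e) :* h :+ (d :- d′)) :- c :* h := (d :- d′) :- e :* h) refl
                (c i) (e i) _ (d i) (d (suc i)))))))
          (solve 3 (λ C E L → L :- (C :- E) := (L :+ E) :- C) refl _ (d 0 - d N) _)
      ; U≤C+E = ≤-respˡ (sym (integral-Σ (λ i → c i + e i)))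
          (Σ-≤-telescope N {d = d} (λ i → ≤-cert (0≤y-x (osc i))
            (solve 5 (λ c e h d d′ → (c :* h :+ (d :- d′)) :- (c :+ e) :* h := (d :- d′) :- e :* h) refl
              (c i) (e i) _ (d i) (d (suc i)))))
      }
      where
      stepFunction : (ℕ → ℝ) → StepFunction 0# 1#
      stepFunction v = record
        { pieces   = N
        ; point    = p ∘ toℕ
        ; value    = v ∘ toℕ
        ; start    = start
        ; end      = trans (reflexive (≡.cong p (toℕ-fromℕ N))) end
        ; monotone = λ i → ≤-respˡ (reflexive (≡.sym (≡.cong p (toℕ-inject₁ i)))) (mono (toℕ i))
        }
      close′ : ∀ (i : Fin N) z → p (toℕ (inject₁ i)) < z → z < p (suc (toℕ i)) →
               f z - c (toℕ i) ◁ e (toℕ i)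
      close′ i z p<z = close (toℕ i) z (≡.subst (λ j → p j < z) (toℕ-inject₁ i) p<z)
      integral-Σ : ∀ v → StepFunction.stepIntegral (stepFunction v) ≈
                   Σ N (λ i → v i * (p (suc i) - p i))
      integral-Σ v = reflexive (sum-cong-≗ {N} (λ i →
        ≡.cong (λ j → v (toℕ i) * (p (suc (toℕ i)) - p j)) (toℕ-inject₁ i)))

-- The sawtooth, its variation and its periodic antiderivative.

module Sawtooth (R : CompleteOrderedField) (lem : ExcludedMiddle 0ℓ) where

  open OrderedField R lem
  open Floor R lem using (IsFloor; fromℤ-suc)

  0≤n·1 : ∀ n → 0# ≤ n · 1#
  0≤n·1 zero    = ≤-refl
  0≤n·1 (suc n) = 0≤1 ⊕ 0≤n·1 n

  ·1-mono-≤ : ∀ {m n} → m ℕ.≤ n → m · 1# ≤ n · 1#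
  ·1-mono-≤ {n = n} ℕ.z≤n = 0≤n·1 n
  ·1-mono-≤ (ℕ.s≤s p)     = +-monoʳ-≤ 1# (·1-mono-≤ p)

  fromℤ-mono-≤ : ∀ {i j} → i ℤ.≤ j → fromℤ i ≤ fromℤ j
  fromℤ-mono-≤ (ℤ.-≤- n≤m) = neg-antimono-≤ (·1-mono-≤ (ℕ.s≤s n≤m))
  fromℤ-mono-≤ {j = + n} (ℤ.-≤+ {m}) = ≤-cert (0≤n·1 n ⊕ 0≤n·1 (suc m))
    (solve 2 (λ a b → a :- (:- b) := a :+ b) refl (n · 1#) (suc m · 1#))
  fromℤ-mono-≤ (ℤ.+≤+ m≤n) = ·1-mono-≤ m≤n

  -- Blocks the unfolding of the search for the floor, which is very costly.
  abstract
    floor : ∀ t → ∃[ k ] IsFloor t k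
    floor = Floor.floor R lem

    floor≡ : ∀ t → floor t ≡ Floor.floor R lem t
    floor≡ t = ≡.refl

  ⌊_⌋ : ℝ → ℤ
  ⌊ t ⌋ = proj₁ (floor t)

  ⌊_⌋ᴿ : ℝ → ℝ
  ⌊ t ⌋ᴿ = fromℤ ⌊ t ⌋

  frac : ℝ → ℝ
  frac t = t - ⌊ t ⌋ᴿ

  frac-nonNegative : ∀ t → 0# ≤ frac t
  frac-nonNegative t = 0≤y-x (proj₁ (proj₂ (floor t)))

  frac-<1 : ∀ t → t < ⌊ t ⌋ᴿ + 1#
  frac-<1 t = proj₂ (proj₂ (floor t))

  0≤1-frac : ∀ t → 0# ≤ 1# - frac t
  0≤1-frac t = ≤-respʳ
    (solve 2 (λ t f → f :+ :1 :- t := :1 :- (t :- f)) refl t ⌊ t ⌋ᴿ) (0≤y-x (proj₁ (frac-<1 t)))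

  floor-nonNegative : ∀ {t} → 0# ≤ t → 0# ≤ ⌊ t ⌋ᴿ
  floor-nonNegative {t} 0≤t = go {⌊ t ⌋} (proj₂ (floor t))
    where
    go : ∀ {k} → IsFloor t k → 0# ≤ fromℤ k
    go {+ n} _ = 0≤n·1 n
    go { -[1+ n ]} (_ , t<k+1) = contradiction
      (≤-trans (≤-cert (0≤n·1 n) (solve 1 (λ n → con (+ 0) :- (:- (:1 :+ n) :+ :1) := n) refl (n · 1#))) 0≤t)
      (<⇒≰ t<k+1)

  -- Beyond monotonicity this gives the unit gap between distinct floors, on which the mean value
  -- estimate rests.
  floor-dichotomy : ∀ {t t′} → t ≤ t′ → ⌊ t ⌋ᴿ ≈ ⌊ t′ ⌋ᴿ ⊎ ⌊ t ⌋ᴿ + 1# ≤ ⌊ t′ ⌋ᴿ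
  floor-dichotomy {t} {t′} t≤t′ = cases (ℤ.<-cmp ⌊ t ⌋ ⌊ t′ ⌋)
    where
    next : ∀ {i j} → i ℤ.< j → fromℤ i + 1# ≤ fromℤ j
    next {i} i<j = ≤-respˡ (fromℤ-suc i) (fromℤ-mono-≤ (ℤ.i<j⇒suc[i]≤j i<j))
    cases : Tri (⌊ t ⌋ ℤ.< ⌊ t′ ⌋) (⌊ t ⌋ ≡ ⌊ t′ ⌋) (⌊ t′ ⌋ ℤ.< ⌊ t ⌋) →
            ⌊ t ⌋ᴿ ≈ ⌊ t′ ⌋ᴿ ⊎ ⌊ t ⌋ᴿ + 1# ≤ ⌊ t′ ⌋ᴿ
    cases (tri< i<j _ _) = inj₂ (next i<j)
    cases (tri≈ _ i≡j _) = inj₁ (reflexive (≡.cong fromℤ i≡j))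
    cases (tri> _ _ j<i) = contradiction
      (≤-trans (next j<i) (≤-trans (proj₁ (proj₂ (floor t))) t≤t′)) (<⇒≰ (frac-<1 t′))

  floor-mono-≤ : ∀ {t t′} → t ≤ t′ → ⌊ t ⌋ᴿ ≤ ⌊ t′ ⌋ᴿ
  floor-mono-≤ {t} {t′} t≤t′ with floor-dichotomy t≤t′
  ... | inj₁ e = ≤-reflexive e
  ... | inj₂ p = ≤-trans (≤-cert 0≤1 (solve 1 (λ f → f :+ :1 :- f := :1) refl ⌊ t ⌋ᴿ)) p

  saw : ℝ → ℝ
  saw t = ½ - frac t

  -- Dominates the variation of saw: saw is the difference of the increasing
  -- functions ½ + ⌊ t ⌋ and t.
  var : ℝ → ℝ
  var t = t + ⌊ t ⌋ᴿ

  saw-◁ : ∀ t → saw t ◁ 1#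
  saw-◁ t =
    ≤-cert (proj₁ 0<½ ⊕ frac-nonNegative t ⊕ ≈⇒0≤*- 1# (sym 2½≈1))
      (solve 2 (λ k f → :1 :- (k :- f) := k :+ f :+ :1 :* (:1 :- :2 :* k)) refl ½ (frac t)) ,
    ≤-cert (proj₁ 0<½ ⊕ 0≤1-frac t)
      (solve 2 (λ k f → :1 :- (:- (k :- f)) := k :+ (:1 :- f)) refl ½ (frac t))

  var-mono-≤ : ∀ {t t′} → t ≤ t′ → var t ≤ var t′
  var-mono-≤ t≤t′ = +-mono-≤ t≤t′ (floor-mono-≤ t≤t′)

  var-nonNegative : ∀ {t} → 0# ≤ t → 0# ≤ var t
  var-nonNegative 0≤t = 0≤t ⊕ floor-nonNegative 0≤t

  saw-variation : ∀ {t t′} → t ≤ t′ → saw t - saw t′ ◁ var t′ - var t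
  saw-variation {t} {t′} t≤t′ =
    ≤-cert (0≤2 ⊗ 0≤y-x (floor-mono-≤ t≤t′))
      (solve 5 (λ k t f t′ f′ → (t′ :+ f′ :- (t :+ f)) :- ((k :- (t :- f)) :- (k :- (t′ :- f′)))
        := :2 :* (f′ :- f)) refl ½ t ⌊ t ⌋ᴿ t′ ⌊ t′ ⌋ᴿ) ,
    ≤-cert (0≤2 ⊗ 0≤y-x t≤t′)
      (solve 5 (λ k t f t′ f′ → (t′ :+ f′ :- (t :+ f)) :- (:- ((k :- (t :- f)) :- (k :- (t′ :- f′))))
        := :2 :* (t′ :- t)) refl ½ t ⌊ t ⌋ᴿ t′ ⌊ t′ ⌋ᴿ)

  -- This is 1/6 minus the periodic second Bernoulli function. It vanishes on both sides of each
  -- integer, so it is continuous, and between integers its derivative is 1 - 2{t}, twice `saw t`.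
  twiceAntiderivative : ℝ → ℝ
  twiceAntiderivative t = frac t * (1# - frac t)

  antiderivative : ℝ → ℝ
  antiderivative t = ½ * twiceAntiderivative t

  twiceAntiderivative-◁ : ∀ t → twiceAntiderivative t ◁ 1#
  twiceAntiderivative-◁ t = 0≤⇒◁ (frac-nonNegative t ⊗ 0≤1-frac t)
    (≤-cert (0≤1-frac t ⊕ frac-nonNegative t ⊗ frac-nonNegative t)
      (solve 1 (λ f → :1 :- f :* (:1 :- f) := (:1 :- f) :+ f :* f) refl (frac t)))

  ½≤1 : ½ ≤ 1#
  ½≤1 = ≤-cert (proj₁ 0<½ ⊕ ≈⇒0≤*- 1# (sym 2½≈1))
    (solve 1 (λ k → :1 :- k := k :+ :1 :* (:1 :- :2 :* k)) refl ½)

  antiderivative-◁ : ∀ t → antiderivative t ◁ 1#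
  antiderivative-◁ t = ◁-weaken (◁-scale (proj₁ 0<½) (twiceAntiderivative-◁ t)) (≤-respˡ (sym (*-identityʳ ½)) ½≤1)

  -- If the floors agree, the function is quadratic in between and the left side is exactly -(t′ -
  -- t)². Otherwise `var` grows by at least 1 and the right side is at least 2(t′ - t), enough for
  -- the increment and the linear term separately.
  twiceAntiderivative-meanValue : ∀ {t t′} → t ≤ t′ →
    (twiceAntiderivative t′ - twiceAntiderivative t) - (1# - 2# * frac t) * (t′ - t) ◁ 2# * ((t′ - t) * (var t′ - var t))
  twiceAntiderivative-meanValue {t} {t′} t≤t′ with floor-dichotomy t≤t′
  ... | inj₁ f≈f′ = ◁-resp
    (trans (solve 3 (λ t f t′ → :- ((t′ :- t) :* (t′ :- t)) :=
        (t′ :- f) :* (:1 :- (t′ :- f)) :- (t :- f) :* (:1 :- (t :- f)) :- (:1 :- :2 :* (t :- f)) :* (t′ :- t))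
      refl t ⌊ t ⌋ᴿ t′)
      (+-congʳ (+-congʳ (*-cong u≈ (+-congˡ (-‿cong u≈))))))
    (trans (solve 3 (λ t f t′ → :2 :* ((t′ :- t) :* (t′ :- t)) := :2 :* ((t′ :- t) :* (t′ :+ f :- (t :+ f))))
      refl t ⌊ t ⌋ᴿ t′) (*-congˡ (*-congˡ (+-congʳ (+-congˡ f≈f′)))))
    (◁-neg (0≤⇒◁ d² (≤-cert d² (solve 1 (λ s → :2 :* s :- s := s) refl ((t′ - t) * (t′ - t))))))
    where
    d² = 0≤y-x t≤t′ ⊗ 0≤y-x t≤t′
    u≈ : t′ - ⌊ t ⌋ᴿ ≈ frac t′
    u≈ = +-congˡ (-‿cong f≈f′)
  ... | inj₂ f+1≤f′ = ◁-weaken (◁-+ increment (◁-neg slope))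
    (≤-cert (0≤2 ⊗ (0≤y-x t≤t′ ⊗ (0≤y-x t≤t′ ⊕ 0≤y-x f+1≤f′)))
      (solve 4 (λ t f t′ f′ → :2 :* ((t′ :- t) :* (t′ :+ f′ :- (t :+ f))) :- ((t′ :- t) :+ (t′ :- t)) :=
        :2 :* ((t′ :- t) :* ((t′ :- t) :+ (f′ :- (f :+ :1))))) refl t ⌊ t ⌋ᴿ t′ ⌊ t′ ⌋ᴿ))
    where
    -- Across an integer t′ - t is at least {t′} + (1 - {t}), and the two function values are at
    -- most {t′} and 1 - {t} respectively.
    increment : twiceAntiderivative t′ - twiceAntiderivative t ◁ t′ - t
    increment =
      ≤-cert (frac-nonNegative t′ ⊗ frac-nonNegative t′ ⊕ 0≤1-frac t ⊕ 0≤y-x f+1≤f′ ⊕ frac-nonNegative t ⊗ 0≤1-frac t)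
        (solve 4 (λ t f t′ f′ → (t′ :- t) :- ((t′ :- f′) :* (:1 :- (t′ :- f′)) :- (t :- f) :* (:1 :- (t :- f))) :=
            (t′ :- f′) :* (t′ :- f′) :+ (:1 :- (t :- f)) :+ (f′ :- (f :+ :1)) :+ (t :- f) :* (:1 :- (t :- f)))
          refl t ⌊ t ⌋ᴿ t′ ⌊ t′ ⌋ᴿ) ,
      ≤-cert (frac-nonNegative t′ ⊕ 0≤1-frac t ⊗ 0≤1-frac t ⊕ 0≤y-x f+1≤f′ ⊕ frac-nonNegative t′ ⊗ 0≤1-frac t′)
        (solve 4 (λ t f t′ f′ → (t′ :- t) :- (:- ((t′ :- f′) :* (:1 :- (t′ :- f′)) :- (t :- f) :* (:1 :- (t :- f)))) :=
            (t′ :- f′) :+ (:1 :- (t :- f)) :* (:1 :- (t :- f)) :+ (f′ :- (f :+ :1)) :+ (t′ :- f′) :* (:1 :- (t′ :- f′)))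
          refl t ⌊ t ⌋ᴿ t′ ⌊ t′ ⌋ᴿ)
    slope : (1# - 2# * frac t) * (t′ - t) ◁ t′ - t
    slope = ◁-resp (*-comm _ _) (*-identityʳ _) (◁-scale (0≤y-x t≤t′)
      (≤-cert (0≤2 ⊗ frac-nonNegative t)
         (solve 1 (λ f → :1 :- (:1 :- :2 :* f) := :2 :* f) refl (frac t)) ,
       ≤-cert (0≤2 ⊗ 0≤1-frac t)
         (solve 1 (λ f → :1 :- (:- (:1 :- :2 :* f)) := :2 :* (:1 :- f)) refl (frac t))))

  antiderivative-meanValue : ∀ {t t′} → t ≤ t′ →
    (antiderivative t′ - antiderivative t) - saw t * (t′ - t) ◁ (t′ - t) * (var t′ - var t)
  antiderivative-meanValue {t} {t′} t≤t′ = ◁-resp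
    (trans (solve 5 (λ k q q′ f d → k :* (q′ :- q :- (:1 :- :2 :* f) :* d) :=
        (k :* q′ :- k :* q) :- (k :- :2 :* k :* f) :* d)
        refl ½ (twiceAntiderivative t) (twiceAntiderivative t′) (frac t) (t′ - t))
      (+-congˡ (-‿cong (*-congʳ (+-congˡ (-‿cong (trans (*-congʳ 2½≈1) (*-identityˡ _))))))))
    (trans (solve 2 (λ k b → k :* (:2 :* b) := :2 :* k :* b) refl ½ _) (trans (*-congʳ 2½≈1) (*-identityˡ _)))
    (◁-scale (proj₁ 0<½) (twiceAntiderivative-meanValue t≤t′))

-- The kernel as a function of the product of its arguments.

module KernelEstimates (R : CompleteOrderedField) (lem : ExcludedMiddle 0ℓ) where

  open OrderedField R lem
  open IntegralEstimates R lem
  open Sawtooth R lem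
  open Kernel R lem using (K; K₂)

  halves-≤ : ∀ {a b ε} → a ≤ ½ * ε → b ≤ ½ * ε → a + b ≤ ε
  halves-≤ {a} {b} {ε} p q = ≤-cert (0≤y-x p ⊕ 0≤y-x q ⊕ ≈⇒0≤*- ε (sym 2½≈1))
    (solve 4 (λ a b ε k → ε :- (a :+ b) := (k :* ε :- a) :+ (k :* ε :- b) :+ ε :* (:1 :- :2 :* k)) refl a b ε ½)

  G W : ℝ → ℝ
  G w = saw (w ⁻¹)
  W w = var (w ⁻¹)

  W-nonNegative : ∀ {w} → 0# < w → 0# ≤ W w
  W-nonNegative p = var-nonNegative (⁻¹-nonNegative p)

  W-antitone : ∀ {w w′} → 0# < w → w ≤ w′ → W w′ ≤ W w
  W-antitone p q = var-mono-≤ (⁻¹-antitone p q)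

  G-variation : ∀ {w w′} → 0# < w → w ≤ w′ → G w - G w′ ◁ W w - W w′
  G-variation {w} {w′} p q = ◁-resp (solve 2 (λ a b → :- (a :- b) := b :- a) refl (G w′) (G w)) refl
    (◁-neg (saw-variation (⁻¹-antitone p q)))

  -- Neither `_⁻¹` nor `floor` comes with a congruence law. Antitonicity of `W`, applied to
  -- `w′ ≤ w`, makes the variation bound nonpositive.
  G-cong : ∀ {w w′} → 0# < w → w ≈ w′ → G w ≈ G w′
  G-cong {w} {w′} p e = ≤-antisym
    (≤-cert (0≤y-x (proj₁ zero-variation))
      (solve 2 (λ a b → b :- a := con (+ 0) :- (a :- b)) refl (G w) (G w′)))
    (≤-cert (0≤y-x (proj₂ zero-variation))
      (solve 2 (λ a b → a :- b := con (+ 0) :- (:- (a :- b))) refl (G w) (G w′)))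
    where
    W≤W′ : W w ≤ W w′
    W≤W′ = W-antitone (<-≤-trans p (≤-reflexive e)) (≤-reflexive (sym e))
    zero-variation : G w - G w′ ◁ 0#
    zero-variation = ◁-weaken (G-variation p (≤-reflexive e))
      (≤-cert (0≤y-x W≤W′) (solve 2 (λ a b → con (+ 0) :- (a :- b) := b :- a) refl (W w) (W w′)))

  ◁-*-difference : ∀ {a a′ b b′ p q} → a - a′ ◁ p → b - b′ ◁ q → a′ ◁ 1# → b ◁ 1# →
                   a * b - a′ * b′ ◁ p + q
  ◁-*-difference {a} {a′} {b} {b′} {p} {q} da db a′◁1 b◁1 = ◁-resp
    (solve 4 (λ a a′ b b′ → (a :- a′) :* b :+ a′ :* (b :- b′) := a :* b :- a′ :* b′) refl a a′ b b′)
    (+-cong (*-identityʳ p) (*-identityˡ q))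
    (◁-+ (◁-* da b◁1) (◁-* a′◁1 db))

  if-yes : ∀ {P : Set} (d : Dec P) {a b : ℝ} → P → (if does d then a else b) ≡ a
  if-yes (yes _) _ = ≡.refl
  if-yes (no ¬p) p = contradiction p ¬p

  if-no : ∀ {P : Set} (d : Dec P) {a b : ℝ} → ¬ P → (if does d then a else b) ≡ b
  if-no (yes p) ¬p = contradiction p ¬p
  if-no (no _)  _  = ≡.refl

  K-positive : ∀ {x z} → 0# < x → 0# < z → K x z ≡ G (x * z)
  K-positive {x} {z} 0<x 0<z = ≡.trans (if-yes lem (0<x , 0<z))
    (≡.cong (λ k → ½ - ((x * z) ⁻¹ - fromℤ (proj₁ k))) (≡.sym (floor≡ ((x * z) ⁻¹))))

  K-zero : ∀ {x z} → ¬ (0# < x × 0# < z) → K x z ≡ 0#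
  K-zero = if-no lem

  K-◁ : ∀ x z → K x z ◁ 1#
  K-◁ x z = cases (lem {0# < x × 0# < z})
    where
    cases : Dec (0# < x × 0# < z) → K x z ◁ 1#
    cases (yes (0<x , 0<z)) = ◁-resp (reflexive (≡.sym (K-positive 0<x 0<z))) refl (saw-◁ ((x * z) ⁻¹))
    cases (no ¬p)           = ◁-resp (reflexive (≡.sym (K-zero ¬p))) refl (0≤⇒◁ ≤-refl 0≤1)

  integrand : ℝ → ℝ → ℝ → ℝ
  integrand x y z = K x z * K z y

  integrand-positive : ∀ {x y z} → 0# < x → 0# < y → 0# < z → integrand x y z ≈ G (x * z) * G (y * z)
  integrand-positive {x} {y} {z} 0<x 0<y 0<z = *-cong (reflexive (K-positive 0<x 0<z))
    (trans (reflexive (K-positive 0<z 0<y)) (G-cong (*-positive 0<z 0<y) (*-comm z y)))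

  node : ℝ → ℝ → ℕ → ℝ
  node η h zero    = η
  node η h (suc i) = node η h i + h

  node-closed : ∀ η h i → node η h i ≈ η + (i · 1#) * h
  node-closed η h zero    = solve 2 (λ η h → η := η :+ con (+ 0) :* h) refl η h
  node-closed η h (suc i) = trans (+-congʳ (node-closed η h i))
    (solve 3 (λ η h m → η :+ m :* h :+ h := η :+ (:1 :+ m) :* h) refl η h (i · 1#))

  -- By the Archimedean property there is a natural number M ≥ A/ε; dividing [η,1] into M cells
  -- gives h A ≤ A/M ≤ ε. Here `A` may depend on `η`, as it does in every application.
  grid : ∀ {η ε A} → η < 1# → 0# ≤ A → 0# ≤ η → 0# < ε →
         ∃[ h ] ∃[ N ] 0# < h × node η h N ≈ 1# × h * A ≤ ε
  grid {η} {ε} {A} η<1 0≤A 0≤η 0<ε = h , suc n ,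
    *-positive (0<y-x η<1) (⁻¹-positive 0<M) ,
    trans (node-closed η h (suc n)) (trans
      (solve 3 (λ η m i → η :+ m :* ((:1 :- η) :* i) := η :+ (:1 :- η) :* (m :* i)) refl η M (M ⁻¹))
      (trans (+-congˡ (*-congˡ MM⁻¹)) (solve 1 (λ η → η :+ (:1 :- η) :* :1 := :1) refl η))) ,
    ≤-cert (0≤η ⊗ 0≤M⁻¹ ⊗ 0≤A ⊕ proj₁ 0<ε ⊗ 0≤M⁻¹ ⊗ 0≤y-x (proj₁ (proj₂ arch))
        ⊕ ≈⇒0≤*- ε (sym MM⁻¹) ⊕ ≈⇒0≤*- (A * M ⁻¹) (*-inverseʳ (0<⇒≉0 0<ε)))
      (solve 6 (λ η M i A ε j → ε :- (:1 :- η) :* i :* A :=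
          η :* i :* A :+ ε :* i :* (M :- A :* j) :+ ε :* (:1 :- M :* i) :+ A :* i :* (ε :* j :- :1))
        refl η M (M ⁻¹) A ε (ε ⁻¹))
    where
    arch = Floor.archimedean R lem (A * ε ⁻¹)
    n = proj₁ arch
    M = suc n · 1#
    0<M : 0# < M
    0<M = 0<⇒0<+ 0<1 (0≤n·1 n)
    0≤M⁻¹ = ⁻¹-nonNegative 0<M
    MM⁻¹ = *-inverseʳ (0<⇒≉0 0<M)
    h = (1# - η) * M ⁻¹

  -- Riemann sums on a uniform grid of [η,1].

  module Grid {η h} (0<η : 0# < η) (0≤h : 0# ≤ h) (N : ℕ) (end : node η h N ≈ 1#) where

    z : ℕ → ℝ
    z = node η h

    z-step : ∀ i → z i ≤ z (suc i)
    z-step i = ≤-cert 0≤h (solve 2 (λ z h → z :+ h :- z := h) refl (z i) h)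

    z-mono : ∀ {i j} → i ℕ.≤′ j → z i ≤ z j
    z-mono ℕ.≤′-refl           = ≤-refl
    z-mono (ℕ.≤′-step {n} i≤j) = ≤-trans (z-mono i≤j) (z-step n)

    η≤z : ∀ i → η ≤ z i
    η≤z i = z-mono (ℕ.≤⇒≤′ (ℕ.z≤n {i}))

    0<z : ∀ i → 0# < z i
    0<z i = <-≤-trans 0<η (η≤z i)

    z≤1 : ∀ {i} → i ℕ.≤ N → z i ≤ 1#
    z≤1 i≤N = ≤-respʳ end (z-mono (ℕ.≤⇒≤′ i≤N))

    riemann : ℝ → ℝ → ℝ
    riemann x y = Σ N λ i → h * (G (x * z (suc i)) * G (y * z (suc i)))

    W-decreasing : ∀ {x} → 0# < x → ∀ i → W (x * z (suc i)) ≤ W (x * z i)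
    W-decreasing 0<x i = W-antitone (*-positive 0<x (0<z i)) (*-monoˡ-≤ (proj₁ 0<x) (z-step i))

    W≤Wη : ∀ {x} → 0# < x → ∀ i → W (x * z i) ≤ W (x * η)
    W≤Wη 0<x i = W-antitone (*-positive 0<x 0<η) (*-monoˡ-≤ (proj₁ 0<x) (η≤z i))

    -- An additional first piece [0,η] covers the accumulation point of the jumps. There the value 0
    -- with error 1 suffices, as the kernel is bounded by 1, and this costs the summand η.
    sandwich-integrand : ∀ {x y} → 0# < x → 0# < y →
      Sandwich (integrand x y) (riemann x y) (η + h * (W (x * η) + W (y * η)))
    sandwich-integrand {x} {y} 0<x 0<y = Sandwich-resp (integrand x y)
      (trans (+-congʳ (zeroˡ _)) (trans (+-identityˡ _) (Σ-cong N (λ i →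
        solve 3 (λ z h g → g :* (z :+ h :- z) := h :* g) refl
          (z i) h (G (x * z (suc i)) * G (y * z (suc i)))))))
      (≤-cert (0≤D N) (solve 3 (λ η D D′ → (η :+ D) :- (η :+ D :- D′) := D′) refl η (D 0) (D N)))
      (sandwich (integrand x y) (suc N) {p} {c} {e} {d} refl end p-step close osc)
      where
      p c e D d : ℕ → ℝ
      p zero    = 0#
      p (suc i) = z i
      c zero    = 0#
      c (suc i) = G (x * z (suc i)) * G (y * z (suc i))
      e zero    = 1#
      e (suc i) = (W (x * z i) - W (x * z (suc i))) + (W (y * z i) - W (y * z (suc i)))
      D i = h * (W (x * z i) + W (y * z i))
      d zero    = η + D 0
      d (suc i) = D i
      0≤D : ∀ i → 0# ≤ D i
      0≤D i = 0≤h ⊗ (W-nonNegative (*-positive 0<x (0<z i)) ⊕ W-nonNegative (*-positive 0<y (0<z i)))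
      p-step : ∀ i → p i ≤ p (suc i)
      p-step zero    = proj₁ 0<η
      p-step (suc i) = z-step i
      osc : ∀ i → e i * (p (suc i) - p i) ≤ d i - d (suc i)
      osc zero    = ≤-reflexive (solve 2 (λ η D → :1 :* (η :- con (+ 0)) := η :+ D :- D) refl η (D 0))
      osc (suc i) = ≤-reflexive (solve 6 (λ z h a b a′ b′ →
          ((a :- a′) :+ (b :- b′)) :* (z :+ h :- z) := h :* (a :+ b) :- h :* (a′ :+ b′)) refl
        (z i) h (W (x * z i)) (W (y * z i)) (W (x * z (suc i))) (W (y * z (suc i))))
      G-close : ∀ {x} → 0# < x → ∀ i {t} → z i < t → t < z (suc i) →
                G (x * t) - G (x * z (suc i)) ◁ W (x * z i) - W (x * z (suc i))
      G-close {x} 0<x i {t} z<t t<z = ◁-weaken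
        (G-variation (*-positive 0<x (≤-<-trans (proj₁ (0<z i)) z<t)) (*-monoˡ-≤ (proj₁ 0<x) (proj₁ t<z)))
        (+-mono-≤ (W-antitone (*-positive 0<x (0<z i)) (*-monoˡ-≤ (proj₁ 0<x) (proj₁ z<t))) ≤-refl)
      close : ∀ i t → p i < t → t < p (suc i) → integrand x y t - c i ◁ e i
      close zero    t 0<t t<η = ◁-resp (solve 1 (λ a → a := a :- con (+ 0)) refl (integrand x y t))
        (*-identityʳ 1#) (◁-* (K-◁ x t) (K-◁ t y))
      close (suc i) t z<t t<z = ◁-resp
        (+-congʳ (sym (integrand-positive 0<x 0<y (≤-<-trans (proj₁ (0<z i)) z<t)))) refl
        (◁-*-difference (G-close 0<x i z<t t<z) (G-close 0<y i z<t t<z) (saw-◁ _) (saw-◁ _))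

    -- Since zᵢ₊₁ ≤ 1, changing x by at most x h moves x zᵢ₊₁ by at most x h, the distance to the
    -- neighbouring nodes x zᵢ and x zᵢ₊₂.
    G-shift : ∀ {x x′} → 0# < x → 0# < x′ → x′ - x ◁ x * h → ∀ i → i ℕ.< N →
              G (x′ * z (suc i)) - G (x * z (suc i)) ◁ W (x * z i) - W (x * z (suc (suc i)))
    G-shift {x} {x′} 0<x 0<x′ (x′-x≤xh , x-x′≤xh) i i<N with ≤-total (x′ * z (suc i)) (x * z (suc i))
    ... | inj₁ q = ◁-weaken (G-variation (*-positive 0<x′ (0<z (suc i))) q)
      (+-mono-≤ (W-antitone (*-positive 0<x (0<z i)) left) (neg-antimono-≤ (W-decreasing 0<x (suc i))))
      where
      left : x * z i ≤ x′ * z (suc i)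
      left = ≤-cert (0≤y-x x-x′≤xh ⊗ proj₁ (0<z (suc i)) ⊕ proj₁ 0<x ⊗ 0≤h ⊗ 0≤y-x (z≤1 i<N))
        (solve 4 (λ x x′ z h → x′ :* (z :+ h) :- x :* z :=
            (x :* h :- (:- (x′ :- x))) :* (z :+ h) :+ x :* h :* (:1 :- (z :+ h))) refl x x′ (z i) h)
    ... | inj₂ q = ◁-resp (solve 2 (λ a b → :- (a :- b) := b :- a) refl _ _) refl (◁-neg
      (◁-weaken (G-variation (*-positive 0<x (0<z (suc i))) q)
        (+-mono-≤ (W-decreasing 0<x i) (neg-antimono-≤ (W-antitone (*-positive 0<x′ (0<z (suc i))) right)))))
      where
      right : x′ * z (suc i) ≤ x * z (suc (suc i))
      right = ≤-cert (0≤y-x x′-x≤xh ⊗ proj₁ (0<z (suc i)) ⊕ proj₁ 0<x ⊗ 0≤h ⊗ 0≤y-x (z≤1 i<N))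
        (solve 4 (λ x x′ z h → x :* (z :+ h) :- x′ :* z :=
            (x :* h :- (x′ :- x)) :* z :+ x :* h :* (:1 :- z)) refl x x′ (z (suc i)) h)

    -- The variation over two adjacent cells still telescopes, with the sum of two neighbouring
    -- values of `W` as potential; the overlap accounts for the factor `2#`.
    riemann-continuous : ∀ {x x′ y y′} → 0# < x → 0# < x′ → 0# < y → 0# < y′ →
      x′ - x ◁ x * h → y′ - y ◁ y * h →
      riemann x′ y′ - riemann x y ◁ 2# * (h * (W (x * η) + W (y * η)))
    riemann-continuous {x} {x′} {y} {y′} 0<x 0<x′ 0<y 0<y′ dx dy = ◁-weaken
      (Σ-◁-telescope N {d = d} λ i i<N → ◁-resp
        (solve 3 (λ h a b → h :* (a :- b) := h :* a :- h :* b) refl h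
          (G (x′ * z (suc i)) * G (y′ * z (suc i))) (G (x * z (suc i)) * G (y * z (suc i))))
        (solve 7 (λ h a b c a′ b′ c′ →
            h :* ((a :- c) :+ (a′ :- c′)) := h :* ((a :+ b) :+ (a′ :+ b′)) :- h :* ((b :+ c) :+ (b′ :+ c′))) refl
          h (W (x * z i)) (W (x * z (suc i))) (W (x * z (suc (suc i))))
            (W (y * z i)) (W (y * z (suc i))) (W (y * z (suc (suc i)))))
        (◁-scale 0≤h (◁-*-difference (G-shift 0<x 0<x′ dx i i<N) (G-shift 0<y 0<y′ dy i i<N) (saw-◁ _) (saw-◁ _))))
      (≤-cert (0≤h ⊗ (0≤y-x (W≤Wη 0<x 1) ⊕ 0≤y-x (W≤Wη 0<y 1)) ⊕ 0≤d N)
        (solve 6 (λ h a b a′ b′ d → :2 :* (h :* (a :+ a′)) :- (h :* ((a :+ b) :+ (a′ :+ b′)) :- d) :=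
            h :* ((a :- b) :+ (a′ :- b′)) :+ d) refl
          h (W (x * η)) (W (x * z 1)) (W (y * η)) (W (y * z 1)) (d N)))
      where
      d : ℕ → ℝ
      d i = h * ((W (x * z i) + W (x * z (suc i))) + (W (y * z i) + W (y * z (suc i))))
      0≤W : ∀ {x} → 0# < x → ∀ i → 0# ≤ W (x * z i)
      0≤W 0<x i = W-nonNegative (*-positive 0<x (0<z i))
      0≤d : ∀ i → 0# ≤ d i
      0≤d i = 0≤h ⊗ ((0≤W 0<x i ⊕ 0≤W 0<x (suc i)) ⊕ (0≤W 0<y i ⊕ 0≤W 0<y (suc i)))

    riemann-symmetric : ∀ x y → riemann x y ≈ riemann y x
    riemann-symmetric x y = Σ-cong N λ i → *-congˡ {h} (*-comm (G (x * z (suc i))) (G (y * z (suc i))))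

    -- With tᵢ = 1/(x zᵢ), the identity h = x zᵢ zᵢ₊₁ (tᵢ - tᵢ₊₁) turns the summands into
    -- increments of an antiderivative of saw; the factor x survives a summation by parts.
    riemann-small : ∀ {x y} → 0# < x → 0# < y →
                    riemann x y ◁ h * W (x * η) + x * (W (y * η) + 4#)
    riemann-small {x} {y} 0<x 0<y = ◁-weaken
      (◁-resp (trans (+-congʳ (+-congˡ (-‿cong (Σ-telescope N b))))
          (solve 3 (λ s b₀ bₙ → s :- (b₀ :- bₙ) :+ (b₀ :- bₙ) := s) refl (riemann x y) (b 0) (b N)))
        refl
        (◁-+ (Σ-◁-telescope N {d = d} summand) (◁-+ (b-◁ ℕ.z≤n) (◁-neg (b-◁ ℕ.≤-refl)))))
      (≤-cert
        (0≤h ⊗ 0≤W 0<x N ⊕ proj₁ 0<x ⊗ 0≤W 0<y N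
          ⊕ 0≤2 ⊗ (proj₁ 0<x ⊗ proj₁ 0<η) ⊕ 0≤2 ⊗ (proj₁ 0<x ⊗ 0≤y-x (z≤1 ℕ.≤-refl)))
        (solve 8 (λ h x z₀ zₙ v₀ vₙ w₀ wₙ →
            h :* v₀ :+ x :* (w₀ :+ (:2 :+ :2)) :-
              ((h :* v₀ :+ x :* (w₀ :- :2 :* z₀)) :- (h :* vₙ :+ x :* (wₙ :- :2 :* zₙ)) :+ (x :+ x)) :=
            h :* vₙ :+ x :* wₙ :+ :2 :* (x :* z₀) :+ :2 :* (x :* (:1 :- zₙ))) refl
          h x η (z N) (W (x * η)) (W (x * z N)) (W (y * η)) (W (y * z N))))
      where
      A : ℕ → ℝ
      A i = antiderivative ((x * z i) ⁻¹)
      b d : ℕ → ℝ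
      -- The weight x zᵢ zᵢ₊₁ is replaced by x zᵢ², so that the term depends on a single index and
      -- telescopes. The replacement costs terms of size x h.
      b i = x * (z i * z i * G (y * z i) * A i)
      -- The three parts pay for the mean value error, for the variation of G(y z), and for two
      -- terms of size x h, h being the increment of z. The last add up to at most 2x and the end
      -- values of `b` to another 2x: hence `4#`.
      d i = h * W (x * z i) + x * (W (y * z i) - 2# * z i)
      0≤W : ∀ {x} → 0# < x → ∀ i → 0# ≤ W (x * z i)
      0≤W 0<x i = W-nonNegative (*-positive 0<x (0<z i))
      z-◁ : ∀ {i} → i ℕ.≤ N → z i ◁ 1#
      z-◁ {i} i≤N = 0≤⇒◁ (proj₁ (0<z i)) (z≤1 i≤N)
      1*1 : ∀ {a} → a ◁ 1# * 1# → a ◁ 1#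
      1*1 = ◁-resp refl (*-identityˡ 1#)
      b-◁ : ∀ {i} → i ℕ.≤ N → b i ◁ x
      b-◁ {i} i≤N = ◁-resp refl (*-identityʳ x) (◁-scale (proj₁ 0<x)
        (1*1 (◁-* (1*1 (◁-* (1*1 (◁-* (z-◁ i≤N) (z-◁ i≤N))) (saw-◁ _))) (antiderivative-◁ _))))
      summand : ∀ i → i ℕ.< N →
        h * (G (x * z (suc i)) * G (y * z (suc i))) - (b i - b (suc i)) ◁ d i - d (suc i)
      summand i i<N = ◁-resp
        (trans (+-congʳ (trans
            (solve 5 (λ c D P s g → :- (c :* (P :- s :* D) :* g) := c :* D :* (s :* g) :- c :* (P :* g)) refl
              c D (A i - A (suc i)) s g′)
            (+-congʳ (*-congʳ cD≈h))))
          (solve 8 (λ h x z s g g′ P P′ →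
              h :* (s :* g′) :- x :* z :* (z :+ h) :* ((P :- P′) :* g′)
                :+ x :* (P :* z :* (z :* (g′ :- g) :+ g′ :* h) :+ P′ :* (z :+ h) :* (g′ :* h)) :=
              h :* (s :* g′) :- (x :* (z :* z :* g :* P) :- x :* ((z :+ h) :* (z :+ h) :* g′ :* P′))) refl
            h x (z i) s g g′ (A i) (A (suc i))))
        (trans (+-congʳ (trans
            (solve 3 (λ c D v → c :* (D :* v) :* :1 := c :* D :* v) refl c D (W (x * z i) - W (x * z (suc i))))
            (*-congʳ cD≈h)))
          (solve 7 (λ h x z v v′ w w′ →
              h :* (v :- v′) :+ x :* (:1 :* (:1 :* (w :- w′) :+ :1 :* h) :+ :1 :* (:1 :* h)) :=
              (h :* v :+ x :* (w :- :2 :* z)) :- (h :* v′ :+ x :* (w′ :- :2 :* (z :+ h)))) refl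
            h x (z i) (W (x * z i)) (W (x * z (suc i))) (W (y * z i)) (W (y * z (suc i)))))
        (◁-+
          (◁-neg (◁-* (◁-scale 0≤c (antiderivative-meanValue t′≤t)) (saw-◁ ((y * z (suc i)) ⁻¹))))
          (◁-scale (proj₁ 0<x) (◁-+
            (◁-* (1*1 (◁-* (antiderivative-◁ _) (z-◁ (ℕ.<⇒≤ i<N))))
              (◁-+ (◁-* (z-◁ (ℕ.<⇒≤ i<N)) g′-g) (◁-* (saw-◁ _) h-◁)))
            (◁-* (1*1 (◁-* (antiderivative-◁ _) (z-◁ i<N))) (◁-* (saw-◁ _) h-◁)))))
        where
        t  = (x * z i) ⁻¹
        t′ = (x * z (suc i)) ⁻¹
        s  = saw t′
        g  = G (y * z i)
        g′ = G (y * z (suc i))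
        c  = x * z i * z (suc i)
        D  = t - t′
        0≤c : 0# ≤ c
        0≤c = proj₁ 0<x ⊗ proj₁ (0<z i) ⊗ proj₁ (0<z (suc i))
        t′≤t : t′ ≤ t
        t′≤t = ⁻¹-antitone (*-positive 0<x (0<z i)) (*-monoˡ-≤ (proj₁ 0<x) (z-step i))
        cD≈h : c * D ≈ h
        cD≈h = trans
          (solve 5 (λ x z z′ t t′ → x :* z :* z′ :* (t :- t′) := z′ :* (x :* z :* t) :- z :* (x :* z′ :* t′))
            refl x (z i) (z (suc i)) t t′)
          (trans (+-cong (*-congˡ (*-inverseʳ (0<⇒≉0 (*-positive 0<x (0<z i)))))
              (-‿cong (*-congˡ (*-inverseʳ (0<⇒≉0 (*-positive 0<x (0<z (suc i))))))))
            (solve 2 (λ z h → (z :+ h) :* :1 :- z :* :1 := h) refl (z i) h))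
        h-◁ : h ◁ h
        h-◁ = 0≤⇒◁ 0≤h ≤-refl
        g′-g : g′ - g ◁ W (y * z i) - W (y * z (suc i))
        g′-g = ◁-resp (solve 2 (λ a b → :- (a :- b) := b :- a) refl g g′) refl
          (◁-neg (G-variation (*-positive 0<y (0<z i)) (*-monoˡ-≤ (proj₁ 0<y) (z-step i))))

  -- From Riemann sums to values of `K₂`.

  K₂-zero : ∀ {x y} → (∀ z → integrand x y z ≈ 0#) → K₂ x y ≈ 0#
  K₂-zero {x} {y} zeros = ≤-antisym
    (≤-cert (0≤y-x (proj₁ bound)) (solve 1 (λ a → con (+ 0) :- a := con (+ 0) :- (a :- con (+ 0))) refl (K₂ x y)))
    (≤-cert (0≤y-x (proj₂ bound)) (solve 1 (λ a → a :- con (+ 0) := con (+ 0) :- (:- (a :- con (+ 0)))) refl (K₂ x y)))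
    where
    ends : ℕ → ℝ
    ends zero    = 0#
    ends (suc _) = 1#
    ends-mono : ∀ i → ends i ≤ ends (suc i)
    ends-mono zero    = 0≤1
    ends-mono (suc _) = ≤-refl
    S : Sandwich (integrand x y) 0# 0#
    S = Sandwich-resp (integrand x y) (trans (+-identityʳ _) (zeroˡ _)) (≤-reflexive (-‿inverseʳ 0#))
      (sandwich (integrand x y) 1 {ends} {λ _ → 0#} {λ _ → 0#} {λ _ → 0#} refl refl ends-mono
        (λ _ z _ _ → ◁-resp (sym (trans (+-congʳ (zeros z)) (-‿inverseʳ 0#))) refl (0≤⇒◁ ≤-refl ≤-refl))
        (λ _ → ≤-reflexive (trans (zeroˡ _) (sym (-‿inverseʳ 0#)))))
    bound : K₂ x y - 0# ◁ 0#
    bound = integral-◁ (integrand x y) (λ ε 0<ε → 0# , 0# , S , proj₁ 0<ε) S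

  ½<1 : ½ < 1#
  ½<1 = ½≤1 , λ e → 0<⇒≉0 0<1 (trans
    (solve 0 (:1 := :2 :* :1 :- :1) refl) (trans (+-congʳ (trans (*-congˡ (sym e)) 2½≈1)) (-‿inverseʳ 1#)))

  -- The given grid may be coarse: integrability is obtained from other, finer grids, after which
  -- the given one already bounds the distance.
  K₂-◁ : ∀ {x y η h} → 0# < x → 0# < y → (0<η : 0# < η) (0≤h : 0# ≤ h) (N : ℕ) (end : node η h N ≈ 1#) →
         K₂ x y - Grid.riemann 0<η 0≤h N end x y ◁ η + h * (W (x * η) + W (y * η))
  K₂-◁ {x} {y} 0<x 0<y 0<η 0≤h N end =
    integral-◁ (integrand x y) fine (Grid.sandwich-integrand 0<η 0≤h N end 0<x 0<y)
    where
    fine : ∀ ε → 0# < ε → ∃[ C ] ∃[ E ] Sandwich (integrand x y) C E × E ≤ ε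
    fine ε 0<ε =
      let η , 0<η , η≤½ , η≤½ε = minimum 0<½ (*-positive 0<½ 0<ε)
          h , N , 0<h , end , hA≤½ε = grid (≤-<-trans η≤½ ½<1)
            (W-nonNegative (*-positive 0<x 0<η) ⊕ W-nonNegative (*-positive 0<y 0<η)) (proj₁ 0<η) (*-positive 0<½ 0<ε)
      in _ , _ , Grid.sandwich-integrand 0<η (proj₁ 0<h) N end 0<x 0<y , halves-≤ η≤½ε hA≤½ε

-- Continuity at interior points and on the axes.

module K₂Continuity (R : CompleteOrderedField) (lem : ExcludedMiddle 0ℓ) where

  open OrderedField R lem
  open IntegralEstimates R lem
  open Sawtooth R lem
  open KernelEstimates R lem
  open Kernel R lem using (K₂)
  open Continuity R using (ContinuousOn; PuncturedUnitSquare)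

  open Grid using (riemann-continuous; riemann-symmetric; riemann-small)

  8# : ℝ
  8# = 4# + 4#

  0<8 : 0# < 8#
  0<8 = 0<⇒0<+ (0<⇒0<+ 0<2 0≤2) 0≤4

  8⁻¹-positive : ∀ {ε} → 0# < ε → 0# < ε * 8# ⁻¹
  8⁻¹-positive 0<ε = *-positive 0<ε (⁻¹-positive 0<8)

  -- The error budget of both cases. At positive points it is 2η for each of two approximations by
  -- Riemann sums and 2η for the change of the sum; 8 in place of 6 makes the inequality strict.
  6η<ε : ∀ {η ε} → 0# < η → η ≤ ε * 8# ⁻¹ → 2# * η + 4# * η < ε
  6η<ε {η} {ε} 0<η p = ≰⇒< λ q → <⇒≰ 0<η (≤-cert
    (half-nonNegative (≤-respʳ
      (solve 3 (λ η ε j → (:4 :+ :4) :* (ε :* j :- η) :+ ε :* (:1 :- (:4 :+ :4) :* j) :+ (:2 :* η :+ :4 :* η :- ε)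
          := (:- η) :+ (:- η)) refl η ε (8# ⁻¹))
      (proj₁ 0<8 ⊗ 0≤y-x p ⊕ ≈⇒0≤*- ε (sym (*-inverseʳ (0<⇒≉0 0<8))) ⊕ 0≤y-x q)))
    (solve 1 (λ η → con (+ 0) :- η := :- η) refl η))
    where
    :4 : ∀ {n} → Polynomial n
    :4 = :2 :+ :2

  half-≤ : ∀ {x x′} → - (x′ - x) ≤ ½ * x → ½ * x ≤ x′
  half-≤ {x} {x′} p = ≤-cert (0≤y-x p ⊕ ≈⇒0≤*- x (sym 2½≈1))
    (solve 3 (λ x x′ k → x′ :- k :* x := (k :* x :- (:- (x′ :- x))) :+ x :* (:1 :- :2 :* k)) refl x x′ ½)

  -- Here `κ` stands for `K₂ x y` or for `K₂ y x`. Symmetry is thus used only for Riemann sums, and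
  -- both axes share one argument.
  Riemann-close : ℝ → ℝ → ℝ → ℝ → Set
  Riemann-close κ x y η = ∀ {h} (0<η : 0# < η) (0≤h : 0# ≤ h) N (end : node η h N ≈ 1#) →
    κ - Grid.riemann 0<η 0≤h N end x y ◁ η + h * (W (x * η) + W (y * η))

  -- The mesh is chosen after x, so that h W(xη), which enters once from each of two estimates, is
  -- absorbed into η. The resulting bound is free of both h and W(xη).
  close⇒small : ∀ {κ x y η} → 0# < x → 0# < y → 0# < η → η < 1# → Riemann-close κ x y η →
                κ ◁ 2# * η + x * (W (y * η) + 4#)
  close⇒small {κ} {x} {y} {η} 0<x 0<y 0<η η<1 close =
    let h , N , 0<h , end , hA≤η = grid η<1 (0≤2 ⊗ 0≤Wx ⊕ 0≤Wy) (proj₁ 0<η) 0<η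
        r = Grid.riemann 0<η (proj₁ 0<h) N end x y
    in ◁-weaken
      (◁-resp (solve 2 (λ k r → k :- r :+ r := k) refl κ r) refl
        (◁-+ (close 0<η (proj₁ 0<h) N end) (riemann-small 0<η (proj₁ 0<h) N end 0<x 0<y)))
      (≤-cert (0≤y-x hA≤η)
        (solve 5 (λ η h v w m → :2 :* η :+ m :- (η :+ h :* (v :+ w) :+ (h :* v :+ m)) := η :- h :* (:2 :* v :+ w))
          refl η h (W (x * η)) (W (y * η)) (x * (W (y * η) + 4#))))
    where
    0≤Wx = W-nonNegative (*-positive 0<x 0<η)
    0≤Wy = W-nonNegative (*-positive 0<y 0<η)

  K₂-◁-sym : ∀ {x y η} → 0# < x → 0# < y → Riemann-close (K₂ y x) x y η
  K₂-◁-sym 0<x 0<y 0<η 0≤h N end = ◁-resp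
    (+-congˡ (-‿cong (riemann-symmetric 0<η 0≤h N end _ _))) (+-congˡ (*-congˡ (+-comm _ _)))
    (K₂-◁ 0<y 0<x 0<η 0≤h N end)

  K₂-zeroˡ : ∀ {x y} → ¬ 0# < x → K₂ x y ≈ 0#
  K₂-zeroˡ {x} {y} 0≮x = K₂-zero λ z →
    trans (*-congʳ (reflexive (K-zero (λ p → 0≮x (proj₁ p))))) (zeroˡ _)

  K₂-zeroʳ : ∀ {x y} → ¬ 0# < y → K₂ x y ≈ 0#
  K₂-zeroʳ {x} {y} 0≮y = K₂-zero λ z →
    trans (*-congˡ (reflexive (K-zero (λ p → 0≮y (proj₂ p))))) (zeroʳ _)

  ZeroAtAxis Small : (ℝ → ℝ → ℝ) → Set
  ZeroAtAxis F = ∀ {x y} → ¬ 0# < x → F x y ≈ 0#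
  Small F = ∀ {x y η} → 0# < x → 0# < y → 0# < η → η < 1# → F x y ◁ 2# * η + x * (W (y * η) + 4#)

  ContinuousAtPositive : (ℝ → ℝ → ℝ) → Set
  ContinuousAtPositive F = ∀ {x y ε} → 0# < x → 0# < y → 0# < ε →
    ∃[ δ ] 0# < δ × (∀ x′ y′ → x′ - x ◁ δ → y′ - y ◁ δ → ∃[ b ] F x′ y′ - F x y ◁ b × b < ε)

  vanishes-at-axis : (F : ℝ → ℝ → ℝ) → ZeroAtAxis F → Small F →
    ∀ {y ε} → 0# < y → 0# < ε →
    ∃[ δ ] 0# < δ × (∀ x′ y′ → x′ ≤ δ → - (y′ - y) ≤ δ → ∃[ b ] F x′ y′ ◁ b × b < ε)
  vanishes-at-axis F zero-at small {y} {ε} 0<y 0<ε =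
    let η , 0<η , η≤½ , η≤ε/8 = minimum 0<½ (8⁻¹-positive 0<ε)
        0<½y = *-positive 0<½ 0<y
        B = 4# + W (½ * y * η)
        0<B : 0# < B
        0<B = 0<⇒0<+ (0<⇒0<+ 0<2 0≤2) (W-nonNegative (*-positive 0<½y 0<η))
        -- δ ≤ y/2 keeps y′ ≥ y/2, so that W(y′η) + 4 ≤ `B`; then δ ≤ η/B bounds x′ (W(y′η) + 4) by
        -- η.
        δ , 0<δ , δ≤½y , δ≤η/B = minimum 0<½y (*-positive 0<η (⁻¹-positive 0<B))
        bound : ∀ x′ y′ → x′ ≤ δ → - (y′ - y) ≤ δ → Dec (0# < x′) → F x′ y′ ◁ 2# * η + 4# * η
        bound x′ y′ x′≤δ y-y′≤δ = λ where
          (no 0≮x′) → ◁-resp (sym (zero-at 0≮x′)) refl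
            (0≤⇒◁ ≤-refl (0≤2 ⊗ proj₁ 0<η ⊕ 0≤4 ⊗ proj₁ 0<η))
          (yes 0<x′) →
            let ½y≤y′ = half-≤ (≤-trans y-y′≤δ δ≤½y)
                0<y′ = <-≤-trans 0<½y ½y≤y′
            in ◁-weaken (small 0<x′ 0<y′ 0<η (≤-<-trans η≤½ ½<1))
              (≤-cert
                (proj₁ 0<x′ ⊗ 0≤y-x (W-antitone (*-positive 0<½y 0<η)
                    (≤-respˡ (*-comm _ _) (≤-respʳ (*-comm _ _) (*-monoˡ-≤ (proj₁ 0<η) ½y≤y′))))
                  ⊕ proj₁ 0<B ⊗ 0≤y-x (≤-trans x′≤δ δ≤η/B)
                  ⊕ ≈⇒0≤*- η (sym (*-inverseʳ (0<⇒≉0 0<B)))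
                  ⊕ (0≤2 ⊕ 0≤1) ⊗ proj₁ 0<η)
                (solve 5 (λ η x w w′ j →
                    :2 :* η :+ (:2 :+ :2) :* η :- (:2 :* η :+ x :* (w′ :+ (:2 :+ :2))) :=
                    x :* (w :- w′) :+ (:2 :+ :2 :+ w) :* (η :* j :- x) :+ η :* (:1 :- (:2 :+ :2 :+ w) :* j)
                      :+ (:2 :+ :1) :* η)
                  refl η x′ (W (½ * y * η)) (W (y′ * η)) (B ⁻¹)))
    in δ , 0<δ , λ x′ y′ x′≤δ y-y′≤δ → _ , bound x′ y′ x′≤δ y-y′≤δ lem , 6η<ε 0<η η≤ε/8

  -- One grid has to serve all nearby points. Its mesh is therefore chosen from the values of `W` at
  -- ½xη and ½yη, which dominate those at every x′ ≥ x/2 and y′ ≥ y/2; only then is δ chosen below x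
  -- h and y h.
  continuous-at-positive : ContinuousAtPositive K₂
  continuous-at-positive {x} {y} {ε} 0<x 0<y 0<ε =
    let η , 0<η , η≤½ , η≤ε/8 = minimum 0<½ (8⁻¹-positive 0<ε)
        0<½x = *-positive 0<½ 0<x
        0<½y = *-positive 0<½ 0<y
        0<½xη = *-positive 0<½x 0<η
        0<½yη = *-positive 0<½y 0<η
        A = W (½ * x * η) + W (½ * y * η)
        h , N , 0<h , end , hA≤η = grid (≤-<-trans η≤½ ½<1)
          (W-nonNegative 0<½xη ⊕ W-nonNegative 0<½yη) (proj₁ 0<η) 0<η
        0≤h = proj₁ 0<h
        δx , 0<δx , δx≤½x , δx≤xh = minimum 0<½x (*-positive 0<x 0<h)
        δy , 0<δy , δy≤½y , δy≤yh = minimum 0<½y (*-positive 0<y 0<h)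
        δ , 0<δ , δ≤δx , δ≤δy = minimum 0<δx 0<δy
        r = Grid.riemann 0<η 0≤h N end
        hW≤η : ∀ {a b} → ½ * x ≤ a → ½ * y ≤ b → h * (W (a * η) + W (b * η)) ≤ η
        hW≤η p q = ≤-trans
          (*-monoˡ-≤ 0≤h (+-mono-≤ (W-antitone 0<½xη (scaleη 0<η p)) (W-antitone 0<½yη (scaleη 0<η q))))
          hA≤η
        error : ∀ {a b} → ½ * x ≤ a → ½ * y ≤ b → K₂ a b - r a b ◁ η + η
        error p q = ◁-weaken (K₂-◁ (<-≤-trans 0<½x p) (<-≤-trans 0<½y q) 0<η 0≤h N end)
          (+-mono-≤ ≤-refl (hW≤η p q))
        bound : ∀ x′ y′ → x′ - x ◁ δ → y′ - y ◁ δ → K₂ x′ y′ - K₂ x y ◁ 2# * η + 4# * η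
        bound x′ y′ dx dy =
          let ½x≤x′ = half-≤ (proj₂ (◁-weaken dx (≤-trans δ≤δx δx≤½x)))
              ½y≤y′ = half-≤ (proj₂ (◁-weaken dy (≤-trans δ≤δy δy≤½y)))
              ½x≤x = half-self 0<x
              ½y≤y = half-self 0<y
          in ◁-resp
            (solve 4 (λ k′ k r′ r → (k′ :- r′) :+ ((r′ :- r) :+ (:- (k :- r))) := k′ :- k) refl
              (K₂ x′ y′) (K₂ x y) (r x′ y′) (r x y))
            (solve 1 (λ η → η :+ η :+ (:2 :* η :+ (η :+ η)) := :2 :* η :+ (:2 :+ :2) :* η) refl η)
            (◁-+ (error ½x≤x′ ½y≤y′) (◁-+
              (◁-weaken (riemann-continuous 0<η 0≤h N end 0<x (<-≤-trans 0<½x ½x≤x′) 0<y (<-≤-trans 0<½y ½y≤y′)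
                  (◁-weaken dx (≤-trans δ≤δx δx≤xh)) (◁-weaken dy (≤-trans δ≤δy δy≤yh)))
                (*-monoˡ-≤ 0≤2 (hW≤η ½x≤x ½y≤y)))
              (◁-neg (error ½x≤x ½y≤y))))
    in δ , 0<δ , λ x′ y′ dx dy → _ , bound x′ y′ dx dy , 6η<ε 0<η η≤ε/8
    where
    scaleη : ∀ {a b η} → 0# < η → a ≤ b → a * η ≤ b * η
    scaleη 0<η p = ≤-respˡ (*-comm _ _) (≤-respʳ (*-comm _ _) (*-monoˡ-≤ (proj₁ 0<η) p))
    half-self : ∀ {x} → 0# < x → ½ * x ≤ x
    half-self {x} 0<x = ≤-respʳ (*-identityˡ x) (scaleη 0<x ½≤1)

  continuousOn-punctured : (F : ℝ → ℝ → ℝ) → ContinuousAtPositive F →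
    ZeroAtAxis F → Small F → ZeroAtAxis (flip F) → Small (flip F) →
    ContinuousOn PuncturedUnitSquare F
  continuousOn-punctured F at-positive zeroˡ smallˡ zeroʳ smallʳ x y ((0≤x , _) , (0≤y , _) , ≉0) ε 0<ε = cases lem lem
    where
    Conclusion : Set
    Conclusion = ∃[ δ ] 0# < δ × (∀ x′ y′ → PuncturedUnitSquare x′ y′ → ∣ x′ - x ∣ < δ → ∣ y′ - y ∣ < δ →
                                  ∣ F x′ y′ - F x y ∣ < ε)
    ∣∣<⇒◁ : ∀ {a δ} → ∣ a ∣ < δ → a ◁ δ
    ∣∣<⇒◁ {a} p = ◁-weaken (∣∣-◁ a) (proj₁ p)
    ≮⇒≈0 : ∀ {x} → 0# ≤ x → ¬ 0# < x → x ≈ 0#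
    ≮⇒≈0 {x} 0≤x 0≮x = zero-or (lem {x ≈ 0#})
      where
      zero-or : Dec (x ≈ 0#) → x ≈ 0#
      zero-or (yes e) = e
      zero-or (no ne) = contradiction (0≤x , λ e → ne (sym e)) 0≮x
    ≈minus-zero : ∀ {a k} → k ≈ 0# → a ≈ a - k
    ≈minus-zero {a} k≈0 = trans (solve 1 (λ a → a := a :- con (+ 0)) refl a) (+-congˡ (-‿cong (sym k≈0)))
    cases : Dec (0# < x) → Dec (0# < y) → Conclusion
    cases (yes 0<x) (yes 0<y) =
      let δ , 0<δ , near = at-positive 0<x 0<y 0<ε
      in δ , 0<δ , λ x′ y′ _ dx dy →
        let b , d , b<ε = near x′ y′ (∣∣<⇒◁ dx) (∣∣<⇒◁ dy) in ≤-<-trans (◁⇒∣∣≤ d) b<ε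
    cases (no 0≮x) (yes 0<y) =
      let δ , 0<δ , near = vanishes-at-axis F zeroˡ smallˡ 0<y 0<ε
      in δ , 0<δ , λ x′ y′ _ dx dy →
        let b , d , b<ε = near x′ y′ (≤-respˡ (sym (≈minus-zero (≮⇒≈0 0≤x 0≮x))) (proj₁ (∣∣<⇒◁ dx))) (proj₂ (∣∣<⇒◁ dy))
        in ≤-<-trans (◁⇒∣∣≤ (◁-resp (≈minus-zero (zeroˡ 0≮x)) refl d)) b<ε
    cases (yes 0<x) (no 0≮y) =
      let δ , 0<δ , near = vanishes-at-axis (flip F) zeroʳ smallʳ 0<x 0<ε
      in δ , 0<δ , λ x′ y′ _ dx dy →
        let b , d , b<ε = near y′ x′ (≤-respˡ (sym (≈minus-zero (≮⇒≈0 0≤y 0≮y))) (proj₁ (∣∣<⇒◁ dy))) (proj₂ (∣∣<⇒◁ dx))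
        in ≤-<-trans (◁⇒∣∣≤ (◁-resp (≈minus-zero (zeroʳ 0≮y)) refl d)) b<ε
    cases (no 0≮x) (no 0≮y) = contradiction (≮⇒≈0 0≤x 0≮x , ≮⇒≈0 0≤y 0≮y) ≉0

  K₂-continuous : ContinuousOn PuncturedUnitSquare K₂
  K₂-continuous = continuousOn-punctured K₂ continuous-at-positive
    K₂-zeroˡ (λ 0<x 0<y 0<η η<1 → close⇒small 0<x 0<y 0<η η<1 (K₂-◁ 0<x 0<y))
    K₂-zeroʳ (λ 0<y 0<x 0<η η<1 → close⇒small 0<y 0<x 0<η η<1 (K₂-◁-sym 0<y 0<x))

theorem2p7 : (R : CompleteOrderedField) (lem : ExcludedMiddle 0ℓ) →
    Continuity.ContinuousOn R (Continuity.PuncturedUnitSquare R) (Kernel.K₂ R lem)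
theorem2p7 R lem = K₂Continuity.K₂-continuous R lem
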